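{- Let $\sigma_1,\dots,\sigma_k$ be non-crossing partitions and let $q<k$ be an index such that $\sigma_q$ is empty, or connected, or has only singleton blocks. Then \[1[\sigma_1]1[\sigma_2]1\cdots1[\sigma_{q-1}]1[\sigma_q]1[\sigma_{q+1}]1[\sigma_{q+2}]1\cdots1[\sigma_k]1\] is cc-equivalent to \[1[\sigma_1]1[\sigma_2]1\cdots1[\sigma_{q-1}]1[\sigma_{q+1}]1[\sigma_q]1[\sigma_{q+2}]1\cdots1[\sigma_k]1.\]
   Context: Set partitions are written in canonical sequential form (restricted growth words). A partition is non-crossing if it avoids the pattern $1212$ (pattern containment = having a subsequence order-isomorphic to the pattern). Bracket notation: in a word built from letters and bracketed partitions, $[\sigma]$ stands for $\sigma+r$ (add $r$ to every letter), where $r$ is the number of distinct symbols appearing before it; e.g. $1[112]1=12231$ and $\alpha[\beta]$ is $\alpha$ followed by $\beta$ shifted by the number of blocks of $\alpha$. A partition is connected if it cannot be written as $\alpha[\beta]$ with $\alpha,\beta$ nonempty; the components of $\pi$ are the unique nonempty connected $\sigma_i$ with $\pi=\sigma_1[\sigma_2]\cdots[\sigma_m]$. Two non-crossing patterns $\sigma,\tau$ are cc-equivalent if there is a bijection from the set of partitions avoiding both $1212$ and $\sigma$ to the set of partitions avoiding both $1212$ and $\tau$ that preserves size and number of components. -}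

module Defs where

open import Data.Fin.Base as Fin using (Fin)
open import Data.List.Base using (List; []; _∷_; _++_; map; concatMap; length; lookup; deduplicate)
open import Data.List.Relation.Unary.All using (All)
open import Data.List.Relation.Unary.Unique.Propositional using (Unique)
open import Data.Nat.Base using (ℕ; suc; _+_; _≤_; _<_; _⊔_)
open import Data.Nat.Properties using (_≟_; ≤-irrelevant)
open import Data.Product.Base using (∃-syntax; _×_; _,_)
open import Function.Bundles using (_⇔_; _⤖_; module Bijection)
open import Relation.Binary.PropositionalEquality using (_≡_; _≢_; refl)
open import Relation.Nullary.Negation using (¬_)

Word : Set
Word = List ℕ

-- RestrictedGrowth m w: w may follow a word whose largest letter is m.
data RestrictedGrowth (m : ℕ) : Word → Set where
  nil  : RestrictedGrowth m []
  cons : ∀ {a w} → 1 ≤ a → a ≤ suc m → RestrictedGrowth (m ⊔ a) w →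
         RestrictedGrowth m (a ∷ w)

-- Canonical sequential forms, on the letters 1, 2, 3, …; the empty partition
-- is included.
IsPartition : Word → Set
IsPartition = RestrictedGrowth 0

record Contains (w p : Word) : Set where
  field
    position   : Fin (length p) → Fin (length w)
    increasing : ∀ i j → i Fin.< j → position i Fin.< position j
    -- Equality of letters is also preserved and reflected, by trichotomy.
    order-iso  : ∀ i j → lookup p i < lookup p j
                       ⇔ lookup w (position i) < lookup w (position j)

Avoids : Word → Word → Set
Avoids w p = ¬ Contains w p

p1212 : Word
p1212 = 1 ∷ 2 ∷ 1 ∷ 2 ∷ []

IsNonCrossing : Word → Set
IsNonCrossing π = IsPartition π × Avoids π p1212

#symbols : Word → ℕ
#symbols w = length (deduplicate _≟_ w)

_⟦_⟧ : Word → Word → Word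
α ⟦ β ⟧ = α ++ map (_+ #symbols α) β

data Item : Set where
  letter  : ℕ → Item
  bracket : Word → Item

-- The first argument is the word already written, which fixes the shift of
-- the next bracket.
evalFrom : Word → List Item → Word
evalFrom w []               = w
evalFrom w (letter a ∷ is)  = evalFrom (w ++ a ∷ []) is
evalFrom w (bracket σ ∷ is) = evalFrom (w ⟦ σ ⟧) is

eval : List Item → Word
eval = evalFrom []

_ : eval (letter 1 ∷ bracket (1 ∷ 1 ∷ 2 ∷ []) ∷ letter 1 ∷ []) ≡ 1 ∷ 2 ∷ 2 ∷ 3 ∷ 1 ∷ []
_ = refl

-- 1[σ₁]1[σ₂]1⋯1[σₖ]1
interleave1 : List Word → Word
interleave1 σs = eval (letter 1 ∷ concatMap (λ σ → bracket σ ∷ letter 1 ∷ []) σs)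

Connected : Word → Set
Connected π = ¬ (∃[ α ] ∃[ β ] IsPartition α × IsPartition β ×
                   α ≢ [] × β ≢ [] × π ≡ α ⟦ β ⟧)

IsComponent : Word → Set
IsComponent σ = IsPartition σ × σ ≢ [] × Connected σ

HasComponents : Word → ℕ → Set
HasComponents π m = ∃[ σs ] length σs ≡ m × All IsComponent σs ×
                      π ≡ eval (map bracket σs)

OnlySingletonBlocks : Word → Set
OnlySingletonBlocks = Unique

record Avoider (σ : Word) : Set where
  constructor avoider
  field
    word        : Word
    isPartition : IsPartition word
    avoids-1212 : Avoids word p1212
    avoids      : Avoids word σ

open Avoider public

RestrictedGrowth-irrelevant : ∀ {m w} (p q : RestrictedGrowth m w) → p ≡ q
RestrictedGrowth-irrelevant nil nil = refl
RestrictedGrowth-irrelevant (cons a b p) (cons c d q)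
  rewrite ≤-irrelevant a c | ≤-irrelevant b d | RestrictedGrowth-irrelevant p q = refl

-- Propositional equality of avoiders is equality of words, so a bijection
-- between Avoider types is a bijection between the sets of partitions.
Avoider-≡ : ∀ {σ} {x y : Avoider σ} → word x ≡ word y → x ≡ y
Avoider-≡ {σ} {avoider w p a b} {avoider .w q c d} refl
  rewrite RestrictedGrowth-irrelevant p q = refl

record CCEquivalent (σ τ : Word) : Set where
  field
    nonCrossingˡ : IsNonCrossing σ
    nonCrossingʳ : IsNonCrossing τ
    bijection    : Avoider σ ⤖ Avoider τ

  open Bijection bijection public using (to)

  field
    size-preserving       : ∀ π → length (word (to π)) ≡ length (word π)
    components-preserving : ∀ π m → HasComponents (word π) m ⇔ HasComponents (word (to π)) m

{-# OPTIONS --safe #-}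

-- A non-crossing partition is a plane forest in which a node with gaps
-- θ₁, …, θₘ stands for 1[θ₁]1⋯1[θₘ]1, and it contains 1[σ₁]1⋯1[σₖ]1 iff the gaps
-- of some node have consecutive factors containing σ₁, …, σₖ in this order.
--
-- Between the shortest prefix of the gaps that matches σ₁, …, σ_{q-1} and the
-- shortest suffix that matches σ_{q+2}, …, σₖ, write the gaps as p r with p the
-- shortest prefix containing σ_q. Replacing p r by r pʳᵉᵛ exchanges the roles of
-- σ_q and σ_{q+1}, because containing σ_q is invariant under reversing the gaps.
--
-- This must be done at all nodes at once, and a change inside a gap may affect
-- which σᵢ it contains. So the rearrangement is replaced by its first-return map
-- to the lists of gaps that contain all the σᵢ (a permutation of a finite set
-- returns), and all other lists are left alone: whatever contains a changed node
-- then contains every σᵢ both before and after.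

module Submission where

open import Defs
open import Data.Empty using (⊥; ⊥-elim)
open import Data.Fin.Base as Fin using (Fin; toℕ; finToFun; funToFin)
open import Data.Fin.Properties as Fin using (any?; all?; finToFun-funToFin; pigeonhole)
open import Data.List.Base
  using (List; []; _∷_; _∷ʳ_; [_]; _++_; map; concat; concatMap; length; lookup; reverse;
         applyUpTo; cartesianProductWith)
open import Data.List.Properties
  using (++-assoc; ++-identityʳ; concat-++; concat-map-[_]; length-++; length-map;
         length-applyUpTo; map-++; map-∘; map-cong; map-cong-local; map-id; reverse-++;
         reverse-involutive; unfold-reverse; ∷-injective; ∷-injectiveˡ; ∷-injectiveʳ)
open import Data.List.Membership.DecPropositional using () renaming (_∈?_ to member?)
open import Data.List.Membership.Propositional using (_∈_; _∉_)
open import Data.List.Membership.Propositional.Properties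
  using (∈-++⁺ˡ; ∈-++⁺ʳ; ∈-++⁻; ∈-map⁺; ∈-map⁻; ∈-∃++; ∈-lookup; ∈-insert; ∈-applyUpTo⁺;
         ∈-applyUpTo⁻; ∈-deduplicate⁺; ∈-deduplicate⁻; ∈-cartesianProductWith⁺)
open import Data.List.Relation.Binary.Permutation.Propositional as ↭
  using (_↭_; ↭-refl; ↭-sym; ↭-trans; ↭-reflexive)
open import Data.List.Relation.Binary.Permutation.Propositional.Properties as ↭
  using (↭-length; ↭-reverse; All-resp-↭; Any-resp-↭)
open import Data.List.Relation.Binary.Sublist.Propositional
  using (_⊆_; []; _∷_; from∈; ⊆-refl; ⊆-trans; minimum)
  renaming (_∷ʳ_ to _⊆∷_; lookup to ∈-resp-⊆)
open import Data.List.Relation.Binary.Sublist.Propositional.Properties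
  using (map⁺; ++⁺; ++⁺ˡ; ++⁺ʳ; ∷ˡ⁻)
open import Data.List.Relation.Unary.All as All using (All; []; _∷_)
open import Data.List.Relation.Unary.All.Properties using (++⁻ʳ)
open import Data.List.Relation.Unary.AllPairs using ([]; _∷_)
open import Data.List.Relation.Unary.Any using (here; there; index)
open import Data.List.Relation.Unary.Any.Properties using (lookup-index)
open import Data.List.Relation.Unary.Unique.DecPropositional.Properties using (deduplicate-!)
open import Data.List.Relation.Unary.Unique.Propositional using (Unique)
open import Data.List.Relation.Unary.Unique.Propositional.Properties using (applyUpTo⁺₁)
open import Data.Nat.Base
  using (ℕ; zero; suc; _+_; _∸_; _⊔_; _<_; _≤_; z≤n; s≤s; s≤s⁻¹; z<s; s<s; s<s⁻¹)
open import Data.Nat.ListAction using (sum)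
open import Data.Nat.ListAction.Properties using (sum-↭)
open import Data.Nat.Properties as ℕ using (_≟_; _≤?_; _<?_; <-cmp)
open import Data.Product.Base using (∃-syntax; ∃₂; _×_; _,_; proj₁; proj₂)
open import Data.Sum.Base using (_⊎_; inj₁; inj₂)
open import Data.Unit.Base using (⊤; tt)
open import Function.Base using (_∘_; id)
open import Function.Bundles using (_⇔_; mk⇔; mk⤖; module Equivalence)
open import Relation.Binary.Definitions using (tri<; tri≈; tri>)
open import Relation.Binary.PropositionalEquality
  using (_≡_; _≢_; refl; sym; trans; cong; cong₂; subst; subst₂; ≢-sym; module ≡-Reasoning)
open import Relation.Nullary using (Dec; yes; no; ¬_)
open import Relation.Nullary.Decidable using (map′; _×-dec_; _⊎-dec_; _→-dec_)
open import Relation.Unary using (Decidable)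

open Equivalence using (to; from)

-- Reversing `p`, instead of merely moving it behind `r`, keeps the cut recoverable. The proper
-- suffixes of the reversed `p` are the reversals of proper prefixes of `p`, so the reversed `p` is
-- again the shortest suffix containing σ_q, and the exchange can be undone. The hypothesis on σ_q
-- enters only through this reversal: a connected pattern occurs inside a single gap, and a pattern
-- of singletons only counts blocks. The obstacle is that reversing `p` may destroy an occurrence of
-- another σᵢ that extends over several gaps, so the exchange need not map the lists containing all
-- the σᵢ to themselves. Its restriction to them is therefore not yet a bijection, and the orbits
-- have to be followed until they come back.

private
  ⇔-refl : {P : Set} → P ⇔ P
  ⇔-refl = mk⇔ id id

  ⇔-sym : {P Q : Set} → P ⇔ Q → Q ⇔ P
  ⇔-sym e = mk⇔ (from e) (to e)

  infixr 4 _⇔∘_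
  _⇔∘_ : {P Q R : Set} → P ⇔ Q → Q ⇔ R → P ⇔ R
  e ⇔∘ f = mk⇔ (to f ∘ to e) (from e ∘ from f)

  ≡⇒⇔ : {P Q : Set} → P ≡ Q → P ⇔ Q
  ≡⇒⇔ refl = ⇔-refl

-- Rearranging lists by their factors

infixr 6 _⋆_

-- The concatenation product of two languages, each given by its membership predicate. A sequence of
-- patterns matched by consecutive factors is an iterated product.
_⋆_ : {A : Set} → (List A → Set) → (List A → Set) → List A → Set
(P ⋆ Q) xs = ∃₂ λ u v → xs ≡ u ++ v × P u × Q v

_ʳ : {A : Set} → (List A → Set) → List A → Set
(P ʳ) xs = P (reverse xs)

LeftClosed : {A : Set} → (List A → Set) → Set
LeftClosed P = ∀ u v → P v → P (u ++ v)

RightClosed : {A : Set} → (List A → Set) → Set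
RightClosed P = ∀ u v → P u → P (u ++ v)

⋆-leftClosed : {A : Set} {P Q : List A → Set} → LeftClosed P → LeftClosed (P ⋆ Q)
⋆-leftClosed lc w _ (u , v , refl , p , q) = w ++ u , v , sym (++-assoc w u v) , lc w u p , q

⋆-rightClosed : {A : Set} {P Q : List A → Set} → RightClosed Q → RightClosed (P ⋆ Q)
⋆-rightClosed rc _ w (u , v , refl , p , q) = u , v ++ w , ++-assoc u v w , p , rc v w q

ʳ-leftClosed : {A : Set} {P : List A → Set} → RightClosed P → LeftClosed (P ʳ)
ʳ-leftClosed {P = P} rc u v p = subst P (sym (reverse-++ u v)) (rc (reverse v) (reverse u) p)

⋆-ʳ : {A : Set} {P Q : List A → Set} → ∀ xs → (P ⋆ Q) xs ⇔ (Q ʳ ⋆ P ʳ) (reverse xs)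
⋆-ʳ {P = P} {Q} xs = mk⇔
  (λ { (u , v , refl , p , q) → reverse v , reverse u , reverse-++ u v ,
       subst Q (sym (reverse-involutive v)) q , subst P (sym (reverse-involutive u)) p })
  (λ { (u , v , e , q , p) → reverse v , reverse u ,
       trans (sym (reverse-involutive xs)) (trans (cong reverse e) (reverse-++ u v)) , p , q })

⋆-assoc : {A : Set} {P Q R : List A → Set} → ∀ xs → (P ⋆ (Q ⋆ R)) xs ⇔ ((P ⋆ Q) ⋆ R) xs
⋆-assoc xs = mk⇔
  (λ { (u , _ , refl , p , v , w , refl , q , r) →
       u ++ v , w , sym (++-assoc u v w) , (u , v , refl , p , q) , r })
  (λ { (_ , w , refl , (u , v , refl , p , q) , r) →
       u , v ++ w , ++-assoc u v w , p , v , w , refl , q , r })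

⋆-cong : {A : Set} {P P′ Q Q′ : List A → Set} →
         (∀ xs → P xs ⇔ P′ xs) → (∀ xs → Q xs ⇔ Q′ xs) → ∀ xs → (P ⋆ Q) xs ⇔ (P′ ⋆ Q′) xs
⋆-cong ep eq xs = mk⇔
  (λ { (u , v , e , p , q) → u , v , e , to (ep u) p , to (eq v) q })
  (λ { (u , v , e , p , q) → u , v , e , from (ep u) p , from (eq v) q })

-- The first factor cannot be empty, so it begins with `x`. The predicate `P ∘ (x ∷_)` is the left
-- quotient of `P`, on which the scan for a shortest prefix recurses.
⋆-∷ : {A : Set} {P Q : List A → Set} → ¬ P [] → ∀ x xs →
      (P ⋆ Q) (x ∷ xs) ⇔ ((P ∘ (x ∷_)) ⋆ Q) xs
⋆-∷ ¬p x xs = mk⇔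
  (λ { ([] , v , e , p , q) → ⊥-elim (¬p p)
     ; (_ ∷ u , v , refl , p , q) → u , v , refl , p , q })
  (λ { (u , v , refl , p , q) → x ∷ u , v , refl , p , q })

¬⋆-[] : {A : Set} {P Q : List A → Set} → ¬ P [] → ¬ (P ⋆ Q) []
¬⋆-[] ¬p ([] , v , e , p , q) = ¬p p
¬⋆-[] ¬p (_ ∷ _ , v , () , p , q)

⋆? : {A : Set} {P Q : List A → Set} → Decidable P → Decidable Q → Decidable (P ⋆ Q)
⋆? P? Q? [] = map′ (λ { (p , q) → [] , [] , refl , p , q })
                   (λ { ([] , [] , refl , p , q) → p , q })
                   (P? [] ×-dec Q? [])
⋆? P? Q? (x ∷ xs) =
  map′ (λ { (inj₁ (p , q)) → [] , x ∷ xs , refl , p , q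
          ; (inj₂ (u , v , refl , p , q)) → x ∷ u , v , refl , p , q })
       (λ { ([] , v , refl , p , q) → inj₁ (p , q)
          ; (_ ∷ u , v , refl , p , q) → inj₂ (u , v , refl , p , q) })
       ((P? [] ×-dec Q? (x ∷ xs)) ⊎-dec ⋆? (P? ∘ (x ∷_)) Q? xs)

-- h is applied behind the shortest prefix satisfying P.
afterFirst : {A : Set} {P : List A → Set} → Decidable P → (List A → List A) → List A → List A
afterFirst P? h xs with P? []
afterFirst P? h xs       | yes _ = h xs
afterFirst P? h []       | no _  = []
afterFirst P? h (x ∷ xs) | no _  = x ∷ afterFirst (P? ∘ (x ∷_)) h xs

module _ {A : Set} where

  afterFirst-↭ : {P : List A → Set} (P? : Decidable P) {h : List A → List A} →
                 (∀ xs → h xs ↭ xs) → ∀ xs → afterFirst P? h xs ↭ xs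
  afterFirst-↭ P? e xs with P? []
  afterFirst-↭ P? e xs       | yes _ = e xs
  afterFirst-↭ P? e []       | no _  = ↭-refl
  afterFirst-↭ P? e (x ∷ xs) | no _  = ↭.prep x (afterFirst-↭ (P? ∘ (x ∷_)) e xs)

  -- Neither `h` nor `h′` touches the prefix that is tested, so the second pass stops where the
  -- first one did.
  afterFirst-inverse : {P : List A → Set} (P? : Decidable P) {h h′ : List A → List A} →
                       (∀ xs → h (h′ xs) ≡ xs) →
                       ∀ xs → afterFirst P? h (afterFirst P? h′ xs) ≡ xs
  afterFirst-inverse P? e xs with P? []
  afterFirst-inverse P? e xs | yes _ = e xs
  afterFirst-inverse P? e [] | no _ = refl
  afterFirst-inverse P? e (x ∷ xs) | no _ =
    cong (x ∷_) (afterFirst-inverse (P? ∘ (x ∷_)) e xs)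

  ⋆-prefix : {P Q : List A → Set} → LeftClosed Q → P [] → ∀ xs → (P ⋆ Q) xs ⇔ Q xs
  ⋆-prefix lc p xs = mk⇔ (λ { (u , v , refl , _ , q) → lc u v q })
                         (λ q → [] , xs , refl , p , q)

  -- Left closure lets the second factor grow leftwards until the first is the shortest prefix in
  -- `P`. Membership in the product thereby becomes a condition on the rest of the list alone, and
  -- `h` acts exactly on this rest.
  afterFirst-⋆ : {P Q Q′ : List A → Set} (P? : Decidable P) {h : List A → List A} →
                 LeftClosed Q → LeftClosed Q′ → (∀ xs → Q xs ⇔ Q′ (h xs)) →
                 ∀ xs → (P ⋆ Q) xs ⇔ (P ⋆ Q′) (afterFirst P? h xs)
  afterFirst-⋆ P? lc lc′ e xs with P? []
  afterFirst-⋆ P? {h} lc lc′ e xs | yes p =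
    ⋆-prefix lc p xs ⇔∘ e xs ⇔∘ ⇔-sym (⋆-prefix lc′ p (h xs))
  afterFirst-⋆ P? lc lc′ e [] | no ¬p =
    mk⇔ (λ s → ⊥-elim (¬⋆-[] ¬p s)) (λ s → ⊥-elim (¬⋆-[] ¬p s))
  afterFirst-⋆ P? lc lc′ e (x ∷ xs) | no ¬p =
    ⋆-∷ ¬p x xs ⇔∘ afterFirst-⋆ (P? ∘ (x ∷_)) lc lc′ e xs ⇔∘ ⇔-sym (⋆-∷ ¬p x _)

  -- Permuting the entries (`fun-↭`) makes orbits finite, keeps the size of the word when the
  -- entries are gaps, and does not affect hits that lie inside a single gap.
  record Rearrangement : Set where
    field
      fun inv : List A → List A
      fun-inv : ∀ xs → fun (inv xs) ≡ xs
      inv-fun : ∀ xs → inv (fun xs) ≡ xs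
      fun-↭   : ∀ xs → fun xs ↭ xs

  open Rearrangement

  inverse : Rearrangement → Rearrangement
  inverse φ = record
    { fun = inv φ ; inv = fun φ ; fun-inv = inv-fun φ ; inv-fun = fun-inv φ
    ; fun-↭ = λ xs → ↭-trans (↭-sym (fun-↭ φ (inv φ xs))) (↭-reflexive (fun-inv φ xs)) }

  afterFirstᴿ : {P : List A → Set} → Decidable P → Rearrangement → Rearrangement
  afterFirstᴿ P? φ = record
    { fun     = afterFirst P? (fun φ)
    ; inv     = afterFirst P? (inv φ)
    ; fun-inv = afterFirst-inverse P? (fun-inv φ)
    ; inv-fun = afterFirst-inverse P? (inv-fun φ)
    ; fun-↭   = afterFirst-↭ P? (fun-↭ φ) }

  infixr 9 _∘ᴿ_
  _∘ᴿ_ : Rearrangement → Rearrangement → Rearrangement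
  φ ∘ᴿ ψ = record
    { fun     = fun φ ∘ fun ψ
    ; inv     = inv ψ ∘ inv φ
    ; fun-inv = λ xs → trans (cong (fun φ) (fun-inv ψ _)) (fun-inv φ xs)
    ; inv-fun = λ xs → trans (cong (inv ψ) (inv-fun φ _)) (inv-fun ψ xs)
    ; fun-↭   = λ xs → ↭-trans (fun-↭ φ _) (fun-↭ ψ xs) }

  reverseᴿ : Rearrangement
  reverseᴿ = record
    { fun = reverse ; inv = reverse
    ; fun-inv = reverse-involutive ; inv-fun = reverse-involutive ; fun-↭ = ↭-reverse }

  -- With xs = p ++ r ++ s, where s is the shortest suffix satisfying M and p
  -- the shortest prefix satisfying C, the result is r ++ reverse p ++ s.
  exchange : {C M : List A → Set} → Decidable C → Decidable M → Rearrangement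
  exchange C? M? =
    reverseᴿ ∘ᴿ afterFirstᴿ (M? ∘ reverse) (afterFirstᴿ C? reverseᴿ ∘ᴿ reverseᴿ) ∘ᴿ reverseᴿ

  -- Regrouped as `(C ⋆ D) ⋆ M`, the condition can be tested in front of the shortest suffix in `M`,
  -- which is found as a prefix of the reversed list. If that front is `p ++ r` with `p` its
  -- shortest prefix in `C`, it lies in `C ⋆ D` iff `r` lies in `D`, and the same condition decides
  -- whether `r ++ reverse p` lies in `D ⋆ C`.
  exchange-⋆ : {C D M : List A → Set} (C? : Decidable C) (M? : Decidable M) →
               (∀ xs → C xs ⇔ C (reverse xs)) → LeftClosed D → RightClosed D →
               LeftClosed C → RightClosed C →
               ∀ xs → (C ⋆ (D ⋆ M)) xs ⇔ (D ⋆ (C ⋆ M)) (fun (exchange C? M?) xs)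
  exchange-⋆ {C} {D} {M} C? M? C-rev lcD rcD lcC rcC xs =
    ⋆-assoc xs ⇔∘
    ⋆-ʳ xs ⇔∘
    afterFirst-⋆ (M? ∘ reverse) (ʳ-leftClosed (⋆-rightClosed {P = C} rcD))
      (ʳ-leftClosed (⋆-rightClosed {P = D} rcC)) inner (reverse xs) ⇔∘
    ≡⇒⇔ (cong (M ʳ ⋆ (D ⋆ C) ʳ) (sym (reverse-involutive _))) ⇔∘
    ⇔-sym (⋆-ʳ {P = D ⋆ C} {Q = M} _) ⇔∘
    ⇔-sym (⋆-assoc _)
    where
    κ = afterFirst C? reverse
    -- `ys` is the front as the outer scan sees it, that is, reversed. Reversing what follows the
    -- shortest prefix in `C` turns `D` into `D ʳ`, and `C-rev` replaces `C` by `C ʳ`.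
    inner : ∀ ys → ((C ⋆ D) ʳ) ys ⇔ ((D ⋆ C) ʳ) (κ (reverse ys))
    inner ys =
      afterFirst-⋆ C? lcD (ʳ-leftClosed rcD)
        (λ zs → ≡⇒⇔ (cong D (sym (reverse-involutive zs)))) (reverse ys) ⇔∘
      ⋆-cong C-rev (λ _ → ⇔-refl) _ ⇔∘
      ≡⇒⇔ (cong (C ʳ ⋆ D ʳ) (sym (reverse-involutive _))) ⇔∘
      ⇔-sym (⋆-ʳ {P = D} {Q = C} (reverse (κ (reverse ys))))

  -- Orbits and first-return maps

  iterate : ℕ → (List A → List A) → List A → List A
  iterate zero    h xs = xs
  iterate (suc n) h xs = iterate n h (h xs)

  iterate-↭ : ∀ φ n xs → iterate n (fun φ) xs ↭ xs
  iterate-↭ φ zero    xs = ↭-refl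
  iterate-↭ φ (suc n) xs = ↭-trans (iterate-↭ φ n _) (fun-↭ φ xs)

  iterate-suc : ∀ h n xs → iterate (suc n) h xs ≡ h (iterate n h xs)
  iterate-suc h zero    xs = refl
  iterate-suc h (suc n) xs = iterate-suc h n (h xs)

  iterate-cancel : ∀ φ m n xs → iterate m (fun φ) xs ≡ iterate (m + n) (fun φ) xs →
                   xs ≡ iterate n (fun φ) xs
  iterate-cancel φ zero    n xs e = e
  iterate-cancel φ (suc m) n xs e = iterate-cancel φ m n xs
    (trans (sym (inv-fun φ _)) (trans (cong (inv φ)
      (trans (sym (iterate-suc (fun φ) m xs)) (trans e (iterate-suc (fun φ) (m + n) xs))))
      (inv-fun φ _)))

  listsOver : List A → ℕ → List (List A)
  listsOver xs zero    = [] ∷ []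
  listsOver xs (suc n) = cartesianProductWith _∷_ xs (listsOver xs n)

  ∈-listsOver : ∀ {xs ys} → All (_∈ xs) ys → ys ∈ listsOver xs (length ys)
  ∈-listsOver []       = here refl
  ∈-listsOver (p ∷ ps) = ∈-cartesianProductWith⁺ _∷_ p (∈-listsOver ps)

  ↭⇒∈-listsOver : ∀ {xs ys} → ys ↭ xs → ys ∈ listsOver xs (length xs)
  ↭⇒∈-listsOver {xs} {ys} p =
    subst (λ n → ys ∈ listsOver xs n) (↭-length p)
      (∈-listsOver (All.tabulate (Any-resp-↭ p)))

  -- All iterates are permutations of `xs` and so lie in the finite list `L`, which may be larger
  -- than the set of permutations. Two of the first `suc (length L)` iterates agree, and injectivity
  -- cancels their common steps.
  period : ∀ φ xs → ∃[ n ] iterate (suc n) (fun φ) xs ≡ xs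
  period φ xs = close (pigeonhole (ℕ.n<1+n (length L)) code)
    where
    L = listsOver xs (length xs)
    mem : (i : Fin (suc (length L))) → iterate (toℕ i) (fun φ) xs ∈ L
    mem i = ↭⇒∈-listsOver (iterate-↭ φ (toℕ i) xs)
    code : Fin (suc (length L)) → Fin (length L)
    code i = index (mem i)
    close : ∃₂ (λ i j → i Fin.< j × code i ≡ code j) → ∃[ n ] iterate (suc n) (fun φ) xs ≡ xs
    close (i , j , i<j , e) with ℕ.m≤n⇒∃[o]m+o≡n i<j
    ... | n , e′ = n , sym (iterate-cancel φ (toℕ i) (suc n) xs
      (trans (lookup-index (mem i)) (trans (cong (lookup L) e)
        (trans (sym (lookup-index (mem j)))
          (cong (λ k → iterate k (fun φ) xs) (sym (trans (ℕ.+-suc (toℕ i) n) e′)))))))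

  -- An orbit segment of at least one step whose interior points lie outside `K`, with no condition
  -- on its ends. A relation of this kind can be reversed step by step, unlike the bounded search
  -- that produces it.
  data Path (K : List A → Set) (h : List A → List A) : List A → List A → Set where
    one  : ∀ {xs} → Path K h xs (h xs)
    step : ∀ {xs ys} → ¬ K (h xs) → Path K h (h xs) ys → Path K h xs ys

  module _ {K : List A → Set} where

    Path-unique : ∀ {h xs ys zs} → K ys → K zs → Path K h xs ys → Path K h xs zs → ys ≡ zs
    Path-unique ky kz one        one        = refl
    Path-unique ky kz one        (step ¬k _) = ⊥-elim (¬k ky)
    Path-unique ky kz (step ¬k _) one        = ⊥-elim (¬k kz)
    Path-unique ky kz (step _ p) (step _ q) = Path-unique ky kz p q

    Path-snoc : ∀ {h xs ys} → Path K h xs ys → ¬ K ys → Path K h xs (h ys)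
    Path-snoc one         ¬k = step ¬k one
    Path-snoc (step ¬k p) ¬k′ = step ¬k (Path-snoc p ¬k′)

    Path-reverse : ∀ φ {xs ys} → Path K (fun φ) xs ys → Path K (inv φ) ys xs
    Path-reverse φ one = subst (Path K (inv φ) _) (inv-fun φ _) one
    Path-reverse φ (step ¬k p) =
      subst (Path K (inv φ) _) (inv-fun φ _) (Path-snoc (Path-reverse φ p) ¬k)

    Path-↭ : ∀ φ {xs ys} → Path K (fun φ) xs ys → ys ↭ xs
    Path-↭ φ one = fun-↭ φ _
    Path-↭ φ (step _ p) = ↭-trans (Path-↭ φ p) (fun-↭ φ _)

    module _ (K? : Decidable K) where

      search : ∀ h n xs → K (iterate (suc n) h xs) → ∃[ ys ] Path K h xs ys × K ys
      search h n xs k with K? (h xs)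
      search h n       xs k | yes k′ = h xs , one , k′
      search h zero    xs k | no ¬k  = ⊥-elim (¬k k)
      search h (suc n) xs k | no ¬k with search h n (h xs) k
      ... | ys , p , k′ = ys , step ¬k p , k′

      return : ∀ φ xs → K xs → ∃[ ys ] Path K (fun φ) xs ys × K ys
      return φ xs k with period φ xs
      ... | n , e = search (fun φ) n xs (subst K (sym e) k)

      firstReturn : Rearrangement → List A → List A
      firstReturn φ xs with K? xs
      ... | yes k = proj₁ (return φ xs k)
      ... | no _  = xs

      -- The graph of the first-return map. It is functional and its converse is the graph for the
      -- inverse rearrangement, so the two maps are mutually inverse whatever bounds their searches
      -- use.
      data FirstReturn (h : List A → List A) (xs : List A) : List A → Set where
        returned : ∀ {ys} → K xs → Path K h xs ys → K ys → FirstReturn h xs ys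
        fixed    : ¬ K xs → FirstReturn h xs xs

      firstReturn-spec : ∀ φ xs → FirstReturn (fun φ) xs (firstReturn φ xs)
      firstReturn-spec φ xs with K? xs
      ... | yes k = let _ , p , k′ = return φ xs k in returned k p k′
      ... | no ¬k = fixed ¬k

      FirstReturn-unique : ∀ {h xs ys zs} → FirstReturn h xs ys → FirstReturn h xs zs → ys ≡ zs
      FirstReturn-unique (returned _ p k) (returned _ q k′) = Path-unique k k′ p q
      FirstReturn-unique (returned k _ _) (fixed ¬k)        = ⊥-elim (¬k k)
      FirstReturn-unique (fixed ¬k)       (returned k _ _)  = ⊥-elim (¬k k)
      FirstReturn-unique (fixed _)        (fixed _)         = refl

      FirstReturn-reverse : ∀ φ {xs ys} → FirstReturn (fun φ) xs ys → FirstReturn (inv φ) ys xs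
      FirstReturn-reverse φ (returned k p k′) = returned k′ (Path-reverse φ p) k
      FirstReturn-reverse φ (fixed ¬k) = fixed ¬k

      FirstReturn-↭ : ∀ φ {xs ys} → FirstReturn (fun φ) xs ys → ys ↭ xs
      FirstReturn-↭ φ (returned _ p _) = Path-↭ φ p
      FirstReturn-↭ φ (fixed _)        = ↭-refl

      inducedᴿ : Rearrangement → Rearrangement
      inducedᴿ φ = record
        { fun     = firstReturn φ
        ; inv     = firstReturn (inverse φ)
        ; fun-inv = λ xs → FirstReturn-unique
            (firstReturn-spec φ _)
            (FirstReturn-reverse (inverse φ) (firstReturn-spec (inverse φ) xs))
        ; inv-fun = λ xs → FirstReturn-unique
            (firstReturn-spec (inverse φ) _) (FirstReturn-reverse φ (firstReturn-spec φ xs))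
        ; fun-↭   = λ xs → FirstReturn-↭ φ (firstReturn-spec φ xs) }

      -- On a path of one step this is `e`. On a longer path both sides are false: the second point
      -- lies outside `K`, hence not in `Y`, so the start is not in `X`; the last point before the
      -- end lies outside `K`, hence not in `X`, so the end is not in `Y`.
      induced-⇔ : ∀ {X Y : List A → Set} φ → (∀ xs → X xs ⇔ Y (fun φ xs)) →
                  (∀ {xs} → X xs → K xs) → (∀ {xs} → Y xs → K xs) →
                  ∀ xs → X xs ⇔ Y (fun (inducedᴿ φ) xs)
      induced-⇔ {X} {Y} φ e X⇒K Y⇒K xs = go (firstReturn-spec φ xs)
        where
        path : ∀ {xs ys} → Path K (fun φ) xs ys → X xs ⇔ Y ys
        path one         = e _
        path (step ¬k p) = mk⇔ (λ x → ⊥-elim (¬k (Y⇒K (to (e _) x))))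
                               (λ y → ⊥-elim (¬k (X⇒K (from (path p) y))))
        go : ∀ {ys} → FirstReturn (fun φ) xs ys → X xs ⇔ Y ys
        go (returned _ p _) = path p
        go (fixed ¬k) = mk⇔ (λ x → ⊥-elim (¬k (X⇒K x))) (λ y → ⊥-elim (¬k (Y⇒K y)))

      induced-fixed-or-K : ∀ φ xs → fun (inducedᴿ φ) xs ≡ xs ⊎ (K xs × K (fun (inducedᴿ φ) xs))
      induced-fixed-or-K φ xs = go (firstReturn-spec φ xs)
        where
        go : ∀ {ys} → FirstReturn (fun φ) xs ys → ys ≡ xs ⊎ (K xs × K ys)
        go (returned k _ k′) = inj₂ (k , k′)
        go (fixed _)         = inj₁ refl

-- Occurrences of patterns

MonoOn : Word → (ℕ → ℕ) → Set
MonoOn p g = ∀ {x y} → x ∈ p → y ∈ p → x < y → g x < g y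

-- An occurrence given by a substitution of letters instead of positions. Shifting and concatenating
-- words then amount to composing or gluing substitutions and to standard facts on sublists.
Has : Word → Word → Set
Has w p = ∃[ g ] MonoOn p g × map g p ⊆ w

MonoOn-injective : ∀ {p g x y} → MonoOn p g → x ∈ p → y ∈ p → g x ≡ g y → x ≡ y
MonoOn-injective {x = x} {y} mono x∈p y∈p e with <-cmp x y
... | tri< x<y _ _ = ⊥-elim (ℕ.<-irrefl e (mono x∈p y∈p x<y))
... | tri≈ _ x≡y _ = x≡y
... | tri> _ _ y<x = ⊥-elim (ℕ.<-irrefl (sym e) (mono y∈p x∈p y<x))

Has-mono : ∀ {w w′ p} → w ⊆ w′ → Has w p → Has w′ p
Has-mono s (g , mono , t) = g , mono , ⊆-trans t s

Has-unshiftᵖ : ∀ {w} r p → Has w (map (_+ r) p) → Has w p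
Has-unshiftᵖ r p (g , mono , s) =
  g ∘ (_+ r) ,
  (λ x∈p y∈p x<y → mono (∈-map⁺ _ x∈p) (∈-map⁺ _ y∈p) (ℕ.+-monoˡ-< r x<y)) ,
  subst (_⊆ _) (sym (map-∘ p)) s

Has-shift : ∀ {p} r w → Has w p → Has (map (_+ r) w) p
Has-shift {p} r w (g , mono , s) =
  (_+ r) ∘ g , (λ x∈p y∈p x<y → ℕ.+-monoˡ-< r (mono x∈p y∈p x<y)) ,
  subst (_⊆ _) (sym (map-∘ p)) (map⁺ (_+ r) s)

map-∸-+ : ∀ r w → map (_∸ r) (map (_+ r) w) ≡ w
map-∸-+ r w = trans (sym (map-∘ w)) (trans (map-cong (λ x → ℕ.m+n∸n≡m x r) w) (map-id w))

Has-unshift : ∀ {p} r w → Has (map (_+ r) w) p → Has w p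
Has-unshift {p} r w (g , mono , s) =
  (_∸ r) ∘ g ,
  (λ {x} {y} x∈p y∈p x<y → ℕ.∸-monoˡ-< (mono x∈p y∈p x<y) (r≤g x∈p)) ,
  subst₂ _⊆_ (sym (map-∘ p)) (map-∸-+ r w) (map⁺ (_∸ r) s)
  where
  -- Truncated subtraction of `r` is strictly monotone only on arguments from `r` on; the values of
  -- `g` are such because they occur in the shifted word.
  r≤g : ∀ {x} → x ∈ p → r ≤ g x
  r≤g x∈p with ∈-map⁻ (_+ r) (∈-resp-⊆ s (∈-map⁺ g x∈p))
  ... | y , _ , e = subst (r ≤_) (sym e) (ℕ.m≤n+m r y)

private
  pred₊ : ∀ {n} (i : Fin (suc n)) → 0 < toℕ i → ∃[ j ] i ≡ Fin.suc j
  pred₊ (Fin.suc j) _ = j , refl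

⊆-fromPositions : (s w : Word) (pos : Fin (length s) → Fin (length w)) →
                  (∀ i j → i Fin.< j → pos i Fin.< pos j) →
                  (∀ i → lookup w (pos i) ≡ lookup s i) → s ⊆ w
⊆-fromPositions []      w       pos inc e = minimum w
⊆-fromPositions (x ∷ s) []      pos inc e with pos Fin.zero
... | ()
⊆-fromPositions (x ∷ s) (y ∷ w) pos inc e with pos Fin.zero in eq
... | Fin.zero = sym (trans (cong (lookup (y ∷ w)) (sym eq)) (e Fin.zero)) ∷
  ⊆-fromPositions s w (proj₁ ∘ pos′)
    (λ i j i<j → s<s⁻¹ (subst₂ Fin._<_ (proj₂ (pos′ i)) (proj₂ (pos′ j))
                         (inc (Fin.suc i) (Fin.suc j) (s<s i<j))))
    (λ i → trans (sym (cong (lookup (y ∷ w)) (proj₂ (pos′ i)))) (e (Fin.suc i)))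
  where
  pos′ : ∀ i → ∃[ j ] pos (Fin.suc i) ≡ Fin.suc j
  pos′ i = pred₊ (pos (Fin.suc i)) (ℕ.≤-<-trans z≤n (inc Fin.zero (Fin.suc i) z<s))
... | Fin.suc k = y ⊆∷
  ⊆-fromPositions (x ∷ s) w (proj₁ ∘ pos′)
    (λ i j i<j → s<s⁻¹ (subst₂ Fin._<_ (proj₂ (pos′ i)) (proj₂ (pos′ j)) (inc i j i<j)))
    (λ i → trans (sym (cong (lookup (y ∷ w)) (proj₂ (pos′ i)))) (e i))
  where
  pos′ : ∀ i → ∃[ j ] pos i ≡ Fin.suc j
  pos′ Fin.zero    = k , eq
  pos′ (Fin.suc i) = pred₊ (pos (Fin.suc i)) (ℕ.≤-<-trans z≤n (inc Fin.zero (Fin.suc i) z<s))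

module _ (g : ℕ → ℕ) where

  positions : ∀ p {w} → map g p ⊆ w → Fin (length p) → Fin (length w)
  positions (x ∷ p) (y ⊆∷ s) i           = Fin.suc (positions (x ∷ p) s i)
  positions (x ∷ p) (e ∷ s)  Fin.zero    = Fin.zero
  positions (x ∷ p) (e ∷ s)  (Fin.suc i) = Fin.suc (positions p s i)

  positions-inc : ∀ p {w} (s : map g p ⊆ w) i j → i Fin.< j → positions p s i Fin.< positions p s j
  positions-inc (x ∷ p) (y ⊆∷ s) i           j           i<j = s<s (positions-inc (x ∷ p) s i j i<j)
  positions-inc (x ∷ p) (e ∷ s)  Fin.zero    (Fin.suc j) i<j = z<s
  positions-inc (x ∷ p) (e ∷ s)  (Fin.suc i) (Fin.suc j) i<j =
    s<s (positions-inc p s i j (s<s⁻¹ i<j))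

  lookup-positions : ∀ p {w} (s : map g p ⊆ w) i → lookup w (positions p s i) ≡ g (lookup p i)
  lookup-positions (x ∷ p) (y ⊆∷ s) i           = lookup-positions (x ∷ p) s i
  lookup-positions (x ∷ p) (e ∷ s)  Fin.zero    = sym e
  lookup-positions (x ∷ p) (e ∷ s)  (Fin.suc i) = lookup-positions p s i

Has⇒Contains : ∀ {w p} → Has w p → Contains w p
Has⇒Contains {w} {p} (g , mono , s) = record
  { position   = positions g p s
  ; increasing = positions-inc g p s
  ; order-iso  = λ i j → mk⇔
      (λ x<y → subst₂ _<_ (sym (lookup-positions g p s i)) (sym (lookup-positions g p s j))
                 (mono (∈-lookup {xs = p} i) (∈-lookup {xs = p} j) x<y))
      (λ gx<gy → reflect i j (subst₂ _<_ (lookup-positions g p s i)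
                                         (lookup-positions g p s j) gx<gy))
  }
  where
  reflect : ∀ i j → g (lookup p i) < g (lookup p j) → lookup p i < lookup p j
  reflect i j lt with <-cmp (lookup p i) (lookup p j)
  ... | tri< x<y _ _ = x<y
  ... | tri≈ _ e _   = ⊥-elim (ℕ.<-irrefl (cong g e) lt)
  ... | tri> _ _ y<x = ⊥-elim (ℕ.<-asym lt (mono (∈-lookup {xs = p} j) (∈-lookup {xs = p} i) y<x))

Contains⇒Has : ∀ {w p} → Contains w p → Has w p
Contains⇒Has {w} {p} c =
  g , mono , ⊆-fromPositions (map g p) w pos′ inc′ look
  where
  open Contains c
  -- A letter goes to whatever stands at the image of one of its positions; by `same` the choice of
  -- the position does not matter. The default 0 is for letters outside `p`, on which `MonoOn p`
  -- imposes nothing.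
  g : ℕ → ℕ
  g x with member? _≟_ x p
  ... | yes x∈p = lookup w (position (index x∈p))
  ... | no _    = 0

  same : ∀ i j → lookup p i ≡ lookup p j → lookup w (position i) ≡ lookup w (position j)
  same i j e with <-cmp (lookup w (position i)) (lookup w (position j))
  ... | tri≈ _ e′ _  = e′
  ... | tri< lt _ _ = ⊥-elim (ℕ.<-irrefl e (from (order-iso i j) lt))
  ... | tri> _ _ gt = ⊥-elim (ℕ.<-irrefl (sym e) (from (order-iso j i) gt))

  g-lookup : ∀ i → g (lookup p i) ≡ lookup w (position i)
  g-lookup i with member? _≟_ (lookup p i) p
  ... | yes m = same (index m) i (sym (lookup-index m))
  ... | no ¬m = ⊥-elim (¬m (∈-lookup i))

  mono : MonoOn p g
  mono x∈p y∈p x<y =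
    subst₂ _<_ (trans (sym (g-lookup (index x∈p))) (cong g (sym (lookup-index x∈p))))
               (trans (sym (g-lookup (index y∈p))) (cong g (sym (lookup-index y∈p))))
      (to (order-iso (index x∈p) (index y∈p))
        (subst₂ _<_ (lookup-index x∈p) (lookup-index y∈p) x<y))

  -- The lengths of `map g q` and `q` agree only propositionally; recursion on `q` converts the
  -- indices without a transport.
  unmap : ∀ q → Fin (length (map g q)) → Fin (length q)
  unmap (_ ∷ q) Fin.zero    = Fin.zero
  unmap (_ ∷ q) (Fin.suc i) = Fin.suc (unmap q i)

  unmap-inc : ∀ q i j → i Fin.< j → unmap q i Fin.< unmap q j
  unmap-inc (_ ∷ q) Fin.zero    (Fin.suc j) _   = z<s
  unmap-inc (_ ∷ q) (Fin.suc i) (Fin.suc j) i<j = s<s (unmap-inc q i j (s<s⁻¹ i<j))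

  lookup-unmap : ∀ q i → lookup (map g q) i ≡ g (lookup q (unmap q i))
  lookup-unmap (_ ∷ q) Fin.zero    = refl
  lookup-unmap (_ ∷ q) (Fin.suc i) = lookup-unmap q i

  pos′ : Fin (length (map g p)) → Fin (length w)
  pos′ i = position (unmap p i)
  inc′ : ∀ i j → i Fin.< j → pos′ i Fin.< pos′ j
  inc′ i j i<j = increasing _ _ (unmap-inc p i j i<j)
  look : ∀ i → lookup w (pos′ i) ≡ lookup (map g p) i
  look i = sym (trans (lookup-unmap p i) (g-lookup (unmap p i)))

-- There are finitely many position maps, and `finToFun` numbers them, so an exhaustive search
-- decides.
Contains? : ∀ w p → Dec (Contains w p)
Contains? w p = map′ decode encode (any? λ c → good? (finToFun c))
  where
  Good : (Fin (length p) → Fin (length w)) → Set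
  Good f = ∀ i j → (i Fin.< j → f i Fin.< f j) ×
                   (lookup p i < lookup p j → lookup w (f i) < lookup w (f j)) ×
                   (lookup w (f i) < lookup w (f j) → lookup p i < lookup p j)
  good? : ∀ f → Dec (Good f)
  good? f = all? λ i → all? λ j →
    (i Fin.<? j →-dec f i Fin.<? f j) ×-dec
    (lookup p i <? lookup p j →-dec lookup w (f i) <? lookup w (f j)) ×-dec
    (lookup w (f i) <? lookup w (f j) →-dec lookup p i <? lookup p j)
  decode : ∃[ c ] Good (finToFun {length w} {length p} c) → Contains w p
  decode (c , good) = record
    { position   = finToFun c
    ; increasing = λ i j → proj₁ (good i j)
    ; order-iso  = λ i j → mk⇔ (proj₁ (proj₂ (good i j))) (proj₂ (proj₂ (good i j))) }
  encode : Contains w p → ∃[ c ] Good (finToFun {length w} {length p} c)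
  encode record { position = f ; increasing = inc ; order-iso = iso } =
    funToFin f , λ i j → transport i j (inc i j , to (iso i j) , from (iso i j))
    where
    P : Fin (length p) → Fin (length p) → Fin (length w) → Fin (length w) → Set
    P i j a b = (i Fin.< j → a Fin.< b) ×
                (lookup p i < lookup p j → lookup w a < lookup w b) ×
                (lookup w a < lookup w b → lookup p i < lookup p j)
    -- Decoding the code of `f` gives back `f` only pointwise, so the condition is carried over for
    -- one pair of values at a time.
    transport : ∀ i j → P i j (f i) (f j) →
                P i j (finToFun (funToFin f) i) (finToFun (funToFin f) j)
    transport i j = subst₂ (P i j) (sym (finToFun-funToFin f i)) (sym (finToFun-funToFin f j))

Has? : ∀ w p → Dec (Has w p)
Has? w p = map′ Contains⇒Has Has⇒Contains (Contains? w p)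

-- Non-crossing partitions as plane forests

data Tree : Set where
  node : List (List Tree) → Tree

Forest : Set
Forest = List Tree

mutual
  blocks : Forest → ℕ
  blocks []            = 0
  blocks (node gs ∷ F) = suc (blocksᴳ gs + blocks F)

  blocksᴳ : List Forest → ℕ
  blocksᴳ []       = 0
  blocksᴳ (θ ∷ gs) = blocks θ + blocksᴳ gs

-- wordOf r F is written on the letters r + 1, …, r + blocks F; a tree
-- node (θ₁ ∷ … ∷ θₘ ∷ []) stands for 1[θ₁]1[θ₂]1⋯1[θₘ]1.
mutual
  wordOf : ℕ → Forest → Word
  wordOf r []            = []
  wordOf r (node gs ∷ F) = suc r ∷ gapsOf (suc r) (suc r) gs ++ wordOf (suc r + blocksᴳ gs) F

  gapsOf : ℕ → ℕ → List Forest → Word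
  gapsOf a r []       = []
  gapsOf a r (θ ∷ gs) = wordOf r θ ++ a ∷ gapsOf a (r + blocks θ) gs

blocks-++ : ∀ F G → blocks (F ++ G) ≡ blocks F + blocks G
blocks-++ []            G = refl
blocks-++ (node gs ∷ F) G =
  cong suc (trans (cong (blocksᴳ gs +_) (blocks-++ F G)) (sym (ℕ.+-assoc (blocksᴳ gs) _ _)))

blocksᴳ-++ : ∀ us vs → blocksᴳ (us ++ vs) ≡ blocksᴳ us + blocksᴳ vs
blocksᴳ-++ []       vs = refl
blocksᴳ-++ (θ ∷ us) vs =
  trans (cong (blocks θ +_) (blocksᴳ-++ us vs)) (sym (ℕ.+-assoc (blocks θ) _ _))

blocks-concat : ∀ gs → blocks (concat gs) ≡ blocksᴳ gs
blocks-concat []       = refl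
blocks-concat (θ ∷ gs) = trans (blocks-++ θ (concat gs)) (cong (blocks θ +_) (blocks-concat gs))

private
  node-offset : ∀ r gs F → r + blocks (node gs ∷ F) ≡ suc r + blocksᴳ gs + blocks F
  node-offset r gs F = trans (ℕ.+-suc r _) (cong suc (sym (ℕ.+-assoc r _ _)))

  gap-offset : ∀ r θ gs → r + blocksᴳ (θ ∷ gs) ≡ r + blocks θ + blocksᴳ gs
  gap-offset r θ gs = sym (ℕ.+-assoc r _ _)

wordOf-++ : ∀ r F G → wordOf r (F ++ G) ≡ wordOf r F ++ wordOf (r + blocks F) G
wordOf-++ r []            G = cong (λ k → wordOf k G) (sym (ℕ.+-identityʳ r))
wordOf-++ r (node gs ∷ F) G = cong (suc r ∷_) (trans
  (cong (gapsOf (suc r) (suc r) gs ++_) (trans (wordOf-++ (suc r + blocksᴳ gs) F G)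
    (cong (λ k → wordOf (suc r + blocksᴳ gs) F ++ wordOf k G) (sym (node-offset r gs F)))))
  (sym (++-assoc (gapsOf (suc r) (suc r) gs) _ _)))

gapsOf-++ : ∀ a r us vs → gapsOf a r (us ++ vs) ≡ gapsOf a r us ++ gapsOf a (r + blocksᴳ us) vs
gapsOf-++ a r []       vs = cong (λ k → gapsOf a k vs) (sym (ℕ.+-identityʳ r))
gapsOf-++ a r (θ ∷ us) vs = trans
  (cong (λ w → wordOf r θ ++ a ∷ w) (trans (gapsOf-++ a (r + blocks θ) us vs)
    (cong (λ k → gapsOf a (r + blocks θ) us ++ gapsOf a k vs) (sym (gap-offset r θ us)))))
  (sym (++-assoc (wordOf r θ) _ _))

private
  swap-+ : ∀ a b c → a + b + c ≡ a + c + b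
  swap-+ a b c = trans (ℕ.+-assoc a b c)
    (trans (cong (a +_) (ℕ.+-comm b c)) (sym (ℕ.+-assoc a c b)))

mutual
  wordOf-shift : ∀ r s F → wordOf (s + r) F ≡ map (_+ r) (wordOf s F)
  wordOf-shift r s []            = refl
  wordOf-shift r s (node gs ∷ F) = cong (suc (s + r) ∷_) (trans
    (cong₂ _++_ (gapsOf-shift r (suc s) (suc s) gs)
      (trans (cong (λ k → wordOf (suc k) F) (swap-+ s r (blocksᴳ gs)))
             (wordOf-shift r (suc s + blocksᴳ gs) F)))
    (sym (map-++ (_+ r) (gapsOf (suc s) (suc s) gs) _)))

  gapsOf-shift : ∀ r a s gs → gapsOf (a + r) (s + r) gs ≡ map (_+ r) (gapsOf a s gs)
  gapsOf-shift r a s []       = refl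
  gapsOf-shift r a s (θ ∷ gs) = trans
    (cong₂ _++_ (wordOf-shift r s θ) (cong (a + r ∷_)
      (trans (cong (λ k → gapsOf (a + r) k gs) (swap-+ s r (blocks θ)))
             (gapsOf-shift r a (s + blocks θ) gs))))
    (sym (map-++ (_+ r) (wordOf s θ) _))

mutual
  wordOf-bounds : ∀ r F {x} → x ∈ wordOf r F → r < x × x ≤ r + blocks F
  wordOf-bounds r (node gs ∷ F) {x} m = weaken (split m)
    where
    split : x ∈ wordOf r (node gs ∷ F) → suc r ≤ x × x ≤ suc r + blocksᴳ gs + blocks F
    split (here refl) = ℕ.≤-refl , ℕ.≤-trans (ℕ.m≤m+n (suc r) (blocksᴳ gs)) (ℕ.m≤m+n _ _)
    split (there m) with ∈-++⁻ (gapsOf (suc r) (suc r) gs) m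
    ... | inj₂ m′ = let l , u = wordOf-bounds _ F m′ in
                    ℕ.≤-trans (s≤s (ℕ.m≤m+n r _)) (ℕ.<⇒≤ l) , u
    ... | inj₁ m′ with gapsOf-bounds (suc r) (suc r) gs m′
    ...   | inj₁ refl    = split (here refl)
    ...   | inj₂ (l , u) = ℕ.<⇒≤ l , ℕ.≤-trans u (ℕ.m≤m+n _ _)
    weaken : suc r ≤ x × x ≤ suc r + blocksᴳ gs + blocks F → r < x × x ≤ r + blocks (node gs ∷ F)
    weaken (l , u) = l , subst (x ≤_) (sym (node-offset r gs F)) u

  gapsOf-bounds : ∀ a r gs {x} → x ∈ gapsOf a r gs → x ≡ a ⊎ (r < x × x ≤ r + blocksᴳ gs)
  gapsOf-bounds a r (θ ∷ gs) {x} m with ∈-++⁻ (wordOf r θ) m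
  ... | inj₁ m′ = let l , u = wordOf-bounds r θ m′ in
                  inj₂ (l , subst (x ≤_) (sym (gap-offset r θ gs)) (ℕ.≤-trans u (ℕ.m≤m+n _ _)))
  ... | inj₂ (here e) = inj₁ e
  ... | inj₂ (there m′) with gapsOf-bounds a (r + blocks θ) gs m′
  ...   | inj₁ e       = inj₁ e
  ...   | inj₂ (l , u) =
    inj₂ (ℕ.≤-<-trans (ℕ.m≤m+n r _) l , subst (x ≤_) (sym (gap-offset r θ gs)) u)

∉-wordOf : ∀ {a r} → a ≤ r → ∀ F → a ∉ wordOf r F
∉-wordOf a≤r F m = ℕ.<⇒≱ (proj₁ (wordOf-bounds _ F m)) a≤r

module _ {A : Set} where

  ∷-++-cancel : ∀ {x : A} u {v u′ v′} → x ∉ u → x ∉ u′ →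
                u ++ x ∷ v ≡ u′ ++ x ∷ v′ → u ≡ u′ × v ≡ v′
  ∷-++-cancel []      {u′ = []}     _ _  e = refl , ∷-injectiveʳ e
  ∷-++-cancel []      {u′ = _ ∷ _}  _ n′ e = ⊥-elim (n′ (here (∷-injectiveˡ e)))
  ∷-++-cancel (_ ∷ u) {u′ = []}     n _  e = ⊥-elim (n (here (sym (∷-injectiveˡ e))))
  ∷-++-cancel (_ ∷ u) {u′ = _ ∷ u′} n n′ e with ∷-injective e
  ... | refl , e′ with ∷-++-cancel u (n ∘ there) (n′ ∘ there) e′
  ...   | refl , e″ = refl , e″

mutual
  wordOf-injective : ∀ r F G → wordOf r F ≡ wordOf r G → F ≡ G
  wordOf-injective r []            []             e = refl
  wordOf-injective r (node gs ∷ F) (node gs′ ∷ G) e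
    with gapsOf-injective (suc r) (suc r) ℕ.≤-refl gs gs′ F G (∷-injectiveʳ e)
  ... | refl , refl = refl
  wordOf-injective r []            (node _ ∷ _)   ()
  wordOf-injective r (node _ ∷ _)  []             ()

  -- The root letter `a` occurs neither inside a gap nor in the trees that follow, so its next
  -- occurrence ends the first gap and its absence ends the list of gaps. The forest behind is
  -- carried along because the word does not mark where the gaps stop.
  gapsOf-injective : ∀ a r → a ≤ r → ∀ gs gs′ F G →
                     gapsOf a r gs ++ wordOf (r + blocksᴳ gs) F ≡
                     gapsOf a r gs′ ++ wordOf (r + blocksᴳ gs′) G → gs ≡ gs′ × F ≡ G
  gapsOf-injective a r a≤r [] [] F G e = refl , wordOf-injective (r + 0) F G e
  gapsOf-injective a r a≤r [] (θ ∷ gs′) F G e =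
    ⊥-elim (∉-wordOf (ℕ.≤-trans a≤r (ℕ.m≤m+n r 0)) F
      (subst (a ∈_) (sym e) (∈-++⁺ˡ (∈-++⁺ʳ (wordOf r θ) (here refl)))))
  gapsOf-injective a r a≤r (θ ∷ gs) [] F G e =
    ⊥-elim (∉-wordOf (ℕ.≤-trans a≤r (ℕ.m≤m+n r 0)) G
      (subst (a ∈_) e (∈-++⁺ˡ (∈-++⁺ʳ (wordOf r θ) (here refl)))))
  gapsOf-injective a r a≤r (θ ∷ gs) (θ′ ∷ gs′) F G e
    with ∷-++-cancel (wordOf r θ) (∉-wordOf a≤r θ) (∉-wordOf a≤r θ′)
           (trans (sym (++-assoc (wordOf r θ) _ _)) (trans e (++-assoc (wordOf r θ′) _ _)))
  ... | e₁ , e₂ with wordOf-injective r θ θ′ e₁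
  ...   | refl with gapsOf-injective a (r + blocks θ) (ℕ.≤-trans a≤r (ℕ.m≤m+n r _)) gs gs′ F G
                     (subst₂ (λ k l → gapsOf a (r + blocks θ) gs ++ wordOf k F ≡
                                gapsOf a (r + blocks θ) gs′ ++ wordOf l G)
                       (gap-offset r θ gs) (gap-offset r θ gs′) e₂)
  ...     | refl , e₃ = refl , e₃

-- Words of forests are non-crossing partitions

mutual
  -- The continuation `w` makes the induction compose: restricted growth is checked from left to
  -- right, and after the forest the maximum is `r + blocks F`.
  wordOf-RG : ∀ r F {w} → RestrictedGrowth (r + blocks F) w → RestrictedGrowth r (wordOf r F ++ w)
  wordOf-RG r []            {w} g = subst (λ k → RestrictedGrowth k w) (ℕ.+-identityʳ r) g
  wordOf-RG r (node gs ∷ F) {w} g =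
    cons (s≤s z≤n) ℕ.≤-refl (subst₂ RestrictedGrowth (sym (ℕ.m≤n⇒m⊔n≡n (ℕ.n≤1+n r)))
      (sym (++-assoc (gapsOf (suc r) (suc r) gs) _ _))
      (gapsOf-RG (suc r) (suc r) (s≤s z≤n) ℕ.≤-refl gs (wordOf-RG _ F
        (subst (λ k → RestrictedGrowth k w) (node-offset r gs F) g))))

  gapsOf-RG : ∀ a r → 1 ≤ a → a ≤ r → ∀ gs {w} →
              RestrictedGrowth (r + blocksᴳ gs) w → RestrictedGrowth r (gapsOf a r gs ++ w)
  gapsOf-RG a r 1≤a a≤r []       {w} g = subst (λ k → RestrictedGrowth k w) (ℕ.+-identityʳ r) g
  gapsOf-RG a r 1≤a a≤r (θ ∷ gs) {w} g =
    subst (RestrictedGrowth r) (sym (++-assoc (wordOf r θ) _ _))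
      (wordOf-RG r θ (cons 1≤a (ℕ.m≤n⇒m≤1+n a≤r′) (subst
        (λ k → RestrictedGrowth k (gapsOf a (r + blocks θ) gs ++ w)) (sym (ℕ.m≥n⇒m⊔n≡m a≤r′))
        (gapsOf-RG a (r + blocks θ) 1≤a a≤r′ gs
          (subst (λ k → RestrictedGrowth k w) (gap-offset r θ gs) g)))))
    where
    a≤r′ : a ≤ r + blocks θ
    a≤r′ = ℕ.≤-trans a≤r (ℕ.m≤m+n r _)

wordOf-isPartition : ∀ F → IsPartition (wordOf 0 F)
wordOf-isPartition F = subst (RestrictedGrowth 0) (++-identityʳ _) (wordOf-RG 0 F nil)

⊆-++⁻ : ∀ u {s v : Word} → s ⊆ u ++ v → ∃₂ λ s₁ s₂ → s ≡ s₁ ++ s₂ × s₁ ⊆ u × s₂ ⊆ v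
⊆-++⁻ []      {s} p        = [] , s , refl , [] , p
⊆-++⁻ (x ∷ u) (.x ⊆∷ p) with ⊆-++⁻ u p
... | s₁ , s₂ , e , p₁ , p₂ = s₁ , s₂ , e , x ⊆∷ p₁ , p₂
⊆-++⁻ (x ∷ u) (e′ ∷ p) with ⊆-++⁻ u p
... | s₁ , s₂ , e , p₁ , p₂ = _ ∷ s₁ , s₂ , cong₂ _∷_ refl e , e′ ∷ p₁ , p₂

-- A form of connectedness that does not presuppose a partition, so it applies to `xyx`, to `xyxy`
-- and to the image of a tree word under any letter map. A linked sublist of two pieces without a
-- common letter lies in one of them.
Linked : Word → Set
Linked s = ∀ p q → s ≡ p ++ q → p ≡ [] ⊎ q ≡ [] ⊎ ∃[ c ] c ∈ p × c ∈ q

Apart : Word → Word → Set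
Apart u v = ∀ {c} → c ∈ u → c ∈ v → ⊥

Linked-⊆-++ : ∀ {s} u {v} → Linked s → Apart u v → s ⊆ u ++ v → s ⊆ u ⊎ s ⊆ v
Linked-⊆-++ u linked apart p with ⊆-++⁻ u p
... | s₁ , s₂ , refl , p₁ , p₂ with linked s₁ s₂ refl
...   | inj₁ refl = inj₂ p₂
...   | inj₂ (inj₁ refl) = inj₁ (subst (_⊆ u) (sym (++-identityʳ s₁)) p₁)
...   | inj₂ (inj₂ (c , c∈s₁ , c∈s₂)) = ⊥-elim (apart (∈-resp-⊆ p₁ c∈s₁) (∈-resp-⊆ p₂ c∈s₂))

⊆-∷⁻ : ∀ {a s} {w : Word} → a ∉ s → s ⊆ a ∷ w → s ⊆ w
⊆-∷⁻ n (_ ⊆∷ p)   = p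
⊆-∷⁻ n (refl ∷ p) = ⊥-elim (n (here refl))

wordOf-apart : ∀ r θ {a k gs} → a ≤ r → r + blocks θ ≤ k → Apart (wordOf r θ) (a ∷ gapsOf a k gs)
wordOf-apart r θ {a} {k} {gs} a≤r b≤k m (here refl) = ∉-wordOf a≤r θ m
wordOf-apart r θ {a} {k} {gs} a≤r b≤k m (there m′) with gapsOf-bounds a k gs m′
... | inj₁ refl    = ∉-wordOf a≤r θ m
... | inj₂ (l , _) = ℕ.<⇒≱ l (ℕ.≤-trans (proj₂ (wordOf-bounds r θ m)) b≤k)

tree-apart : ∀ r gs F → Apart (suc r ∷ gapsOf (suc r) (suc r) gs) (wordOf (suc r + blocksᴳ gs) F)
tree-apart r gs F (here refl) m′ = ∉-wordOf (ℕ.m≤m+n (suc r) _) F m′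
tree-apart r gs F (there m) m′ with gapsOf-bounds (suc r) (suc r) gs m
... | inj₁ refl    = ∉-wordOf (ℕ.m≤m+n (suc r) _) F m′
... | inj₂ (_ , u) = ∉-wordOf u F m′

xyx-linked : ∀ x y → Linked (x ∷ y ∷ x ∷ [])
xyx-linked x y []                  q  e = inj₁ refl
xyx-linked x y (_ ∷ [])            q  refl = inj₂ (inj₂ (x , here refl , there (here refl)))
xyx-linked x y (_ ∷ _ ∷ [])        q  refl = inj₂ (inj₂ (x , here refl , here refl))
xyx-linked x y (_ ∷ _ ∷ _ ∷ [])    [] e = inj₂ (inj₁ refl)

xyxy-linked : ∀ x y → Linked (x ∷ y ∷ x ∷ y ∷ [])
xyxy-linked x y []                   q  e = inj₁ refl
xyxy-linked x y (_ ∷ [])             q  refl = inj₂ (inj₂ (x , here refl , there (here refl)))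
xyxy-linked x y (_ ∷ _ ∷ [])         q  refl = inj₂ (inj₂ (x , here refl , here refl))
xyxy-linked x y (_ ∷ _ ∷ _ ∷ [])     q  refl = inj₂ (inj₂ (y , there (here refl) , here refl))
xyxy-linked x y (_ ∷ _ ∷ _ ∷ _ ∷ []) [] e = inj₂ (inj₁ refl)

-- A letter other than the root letter `a` occurs in one gap only, and no gap contains `a`. Every
-- crossing that involves a root reduces to this case.
xax⊈gapsOf : ∀ {a x} r gs → a ≤ r → x ≢ a → ¬ (x ∷ a ∷ x ∷ [] ⊆ gapsOf a r gs)
xax⊈gapsOf r [] a≤r x≢a ()
xax⊈gapsOf {a} {x} r (θ ∷ gs) a≤r x≢a p
  with Linked-⊆-++ (wordOf r θ) (xyx-linked x a) (wordOf-apart r θ {gs = gs} a≤r ℕ.≤-refl) p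
... | inj₁ q = ∉-wordOf a≤r θ (∈-resp-⊆ q (there (here refl)))
... | inj₂ (_ ⊆∷ q) = xax⊈gapsOf (r + blocks θ) gs (ℕ.≤-trans a≤r (ℕ.m≤m+n r _)) x≢a q
... | inj₂ (x≡a ∷ _) = x≢a x≡a

mutual
  xyxy⊈wordOf : ∀ {x y} r F → x ≢ y → ¬ (x ∷ y ∷ x ∷ y ∷ [] ⊆ wordOf r F)
  xyxy⊈wordOf {x} {y} r (node gs ∷ F) x≢y p
    with Linked-⊆-++ (suc r ∷ gapsOf (suc r) (suc r) gs) (xyxy-linked x y) (tree-apart r gs F) p
  ... | inj₂ q = xyxy⊈wordOf (suc r + blocksᴳ gs) F x≢y q
  ... | inj₁ (refl ∷ q) = xax⊈gapsOf (suc r) gs ℕ.≤-refl (≢-sym x≢y) q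
  ... | inj₁ (_ ⊆∷ q) with x ≟ suc r | y ≟ suc r
  ...   | yes refl | _       = xax⊈gapsOf (suc r) gs ℕ.≤-refl (≢-sym x≢y) (⊆-trans (x ⊆∷ ⊆-refl) q)
  ...   | no x≢a   | yes refl =
    xax⊈gapsOf (suc r) gs ℕ.≤-refl x≢a (⊆-trans (refl ∷ refl ∷ refl ∷ y ⊆∷ []) q)
  ...   | no x≢a   | no y≢a  = xyxy⊈gapsOf (suc r) (suc r) gs ℕ.≤-refl x≢a y≢a x≢y q

  xyxy⊈gapsOf : ∀ {x y} a r gs → a ≤ r → x ≢ a → y ≢ a → x ≢ y →
                ¬ (x ∷ y ∷ x ∷ y ∷ [] ⊆ gapsOf a r gs)
  xyxy⊈gapsOf {x} {y} a r (θ ∷ gs) a≤r x≢a y≢a x≢y p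
    with Linked-⊆-++ (wordOf r θ) (xyxy-linked x y) (wordOf-apart r θ {gs = gs} a≤r ℕ.≤-refl) p
  ... | inj₁ q          = xyxy⊈wordOf r θ x≢y q
  ... | inj₂ (x≡a ∷ _)  = x≢a x≡a
  ... | inj₂ (_ ⊆∷ q)   =
    xyxy⊈gapsOf a (r + blocks θ) gs (ℕ.≤-trans a≤r (ℕ.m≤m+n r _)) x≢a y≢a x≢y q

wordOf-avoids-1212 : ∀ F → Avoids (wordOf 0 F) p1212
wordOf-avoids-1212 F c with Contains⇒Has c
... | g , mono , s =
  xyxy⊈wordOf 0 F (λ e → ℕ.<-irrefl e (mono (here refl) (there (here refl)) (s≤s (s≤s z≤n)))) s

-- Parsing non-crossing partitions

Crossing : Word → Set
Crossing w = ∃₂ λ x y → x < y × x ∷ y ∷ x ∷ y ∷ [] ⊆ w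

Crossing⇒Has : ∀ {w} → Crossing w → Has w p1212
Crossing⇒Has {w} (x , y , x<y , s) = g , mono , s
  where
  g : ℕ → ℕ
  g 1 = x
  g _ = y
  12-only : ∀ {z} → z ∈ p1212 → z ≡ 1 ⊎ z ≡ 2
  12-only (here e)                         = inj₁ e
  12-only (there (here e))                 = inj₂ e
  12-only (there (there (here e)))         = inj₁ e
  12-only (there (there (there (here e)))) = inj₂ e
  mono : MonoOn p1212 g
  mono u∈ v∈ u<v with 12-only u∈ | 12-only v∈
  ... | inj₁ refl | inj₁ refl = ⊥-elim (ℕ.<-irrefl refl u<v)
  ... | inj₁ refl | inj₂ refl = x<y
  ... | inj₂ refl | inj₁ refl = ⊥-elim (ℕ.<-asym u<v ℕ.≤-refl)
  ... | inj₂ refl | inj₂ refl = ⊥-elim (ℕ.<-irrefl refl u<v)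

mutual
  wordOf-covers : ∀ r F {x} → r < x → x ≤ r + blocks F → x ∈ wordOf r F
  wordOf-covers r []            l u = ⊥-elim (ℕ.<⇒≱ l (subst (_ ≤_) (ℕ.+-identityʳ r) u))
  wordOf-covers r (node gs ∷ F) {x} l u with x ≤? suc r + blocksᴳ gs
  ... | yes u′ = ∈-++⁺ˡ (node-covers r gs l u′)
  ... | no u′  = there (∈-++⁺ʳ (gapsOf (suc r) (suc r) gs)
                   (wordOf-covers _ F (ℕ.≰⇒> u′) (subst (x ≤_) (node-offset r gs F) u)))

  node-covers : ∀ r gs {x} → r < x → x ≤ suc r + blocksᴳ gs → x ∈ suc r ∷ gapsOf (suc r) (suc r) gs
  node-covers r gs {x} l u with x ≟ suc r
  ... | yes e = here e
  ... | no ¬e = there (gapsOf-covers (suc r) (suc r) gs (ℕ.≤∧≢⇒< l (≢-sym ¬e)) u)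

  gapsOf-covers : ∀ a r gs {x} → r < x → x ≤ r + blocksᴳ gs → x ∈ gapsOf a r gs
  gapsOf-covers a r []       l u = ⊥-elim (ℕ.<⇒≱ l (subst (_ ≤_) (ℕ.+-identityʳ r) u))
  gapsOf-covers a r (θ ∷ gs) {x} l u with x ≤? r + blocks θ
  ... | yes u′ = ∈-++⁺ˡ (wordOf-covers r θ l u′)
  ... | no u′  = ∈-++⁺ʳ (wordOf r θ) (there
                   (gapsOf-covers a _ gs (ℕ.≰⇒> u′) (subst (x ≤_) (gap-offset r θ gs) u)))

gapsOf-last : ∀ a r gs → gs ≡ [] ⊎ ∃[ w ] gapsOf a r gs ≡ w ∷ʳ a
gapsOf-last a r [] = inj₁ refl
gapsOf-last a r (θ ∷ gs) with gapsOf-last a (r + blocks θ) gs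
... | inj₁ refl    = inj₂ (wordOf r θ , refl)
... | inj₂ (w , e) = inj₂ (wordOf r θ ++ a ∷ w ,
  trans (cong (λ v → wordOf r θ ++ a ∷ v) e) (sym (++-assoc (wordOf r θ) (a ∷ w) _)))

-- A letter of a block nested in the first tree cannot be repeated at the end:
-- the first tree ends with its root letter, and the two would cross.
append-old : ∀ r F x → r < x → x ≤ r + blocks F → ¬ Crossing (wordOf r F ∷ʳ x) →
             ∃[ G ] wordOf r G ≡ wordOf r F ∷ʳ x
append-old r []            x l u _ = ⊥-elim (ℕ.<⇒≱ l (subst (x ≤_) (ℕ.+-identityʳ r) u))
append-old r (node gs ∷ F) x l u nc with x ≤? suc r + blocksᴳ gs | x ≟ suc r
... | _ | yes refl = node (gs ∷ʳ F) ∷ [] , cong (x ∷_) (begin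
  gapsOf x x (gs ∷ʳ F) ++ []                              ≡⟨ ++-identityʳ _ ⟩
  gapsOf x x (gs ∷ʳ F)                                    ≡⟨ gapsOf-++ x x gs (F ∷ []) ⟩
  gapsOf x x gs ++ (wordOf (x + blocksᴳ gs) F ++ x ∷ [])  ≡⟨ sym (++-assoc (gapsOf x x gs) _ _) ⟩
  (gapsOf x x gs ++ wordOf (x + blocksᴳ gs) F) ++ x ∷ []  ∎)
  where open ≡-Reasoning
... | no x≰ | no _ =
  let a = suc r
      G , e = append-old (a + blocksᴳ gs) F x (ℕ.≰⇒> x≰) (subst (x ≤_) (node-offset r gs F) u)
                (λ (y , z , y<z , s) → nc (y , z , y<z ,
                  subst (y ∷ z ∷ y ∷ z ∷ [] ⊆_) (sym (++-assoc (a ∷ gapsOf a a gs) _ _))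
                    (++⁺ˡ (a ∷ gapsOf a a gs) s)))
  in node gs ∷ G , cong (a ∷_) (trans (cong (gapsOf a a gs ++_) e)
                                      (sym (++-assoc (gapsOf a a gs) _ _)))
... | yes x≤ | no x≢ with gapsOf-last (suc r) (suc r) gs
...   | inj₁ refl = ⊥-elim (x≢ (ℕ.≤-antisym (subst (x ≤_) (ℕ.+-identityʳ (suc r)) x≤) l))
...   | inj₂ (w , e) = ⊥-elim (nc (suc r , x , ℕ.≤∧≢⇒< l (≢-sym x≢) ,
  refl ∷ ++⁺ (++⁺ʳ (wordOf (suc r + blocksᴳ gs) F) xa) (refl ∷ [])))
  where
  x∈w : x ∈ w
  x∈w with node-covers r gs l x≤
  ... | here x≡a = ⊥-elim (x≢ x≡a)
  ... | there m with ∈-++⁻ w (subst (x ∈_) e m)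
  ...   | inj₁ m′         = m′
  ...   | inj₂ (here x≡a) = ⊥-elim (x≢ x≡a)
  xa : x ∷ suc r ∷ [] ⊆ gapsOf (suc r) (suc r) gs
  xa = subst (_ ⊆_) (sym e) (++⁺ (from∈ x∈w) ⊆-refl)

max : ℕ → Word → ℕ
max m []      = m
max m (x ∷ w) = max (m ⊔ x) w

RG-∷ʳ⁻ : ∀ {m} w {x} → RestrictedGrowth m (w ∷ʳ x) →
         RestrictedGrowth m w × 1 ≤ x × x ≤ suc (max m w)
RG-∷ʳ⁻ []      (cons l u _) = nil , l , u
RG-∷ʳ⁻ (y ∷ w) (cons l u g) = let g′ , l′ , u′ = RG-∷ʳ⁻ w g in cons l u g′ , l′ , u′

max-bound : ∀ {k} m w → m ≤ k → (∀ {x} → x ∈ w → x ≤ k) → max m w ≤ k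
max-bound m []      m≤k b = m≤k
max-bound m (y ∷ w) m≤k b = max-bound (m ⊔ y) w (ℕ.⊔-lub m≤k (b (here refl))) (b ∘ there)

-- The word is read from left to right, so the induction runs over the reversed list and each step
-- appends a letter. A new letter becomes a tree with one node; an old one must be the root of a
-- top-level tree, and all trees behind that tree become its last gap.
parseReversed : ∀ v → IsPartition (reverse v) → ¬ Crossing (reverse v) →
                ∃[ F ] wordOf 0 F ≡ reverse v
parseReversed []      _ _ = [] , refl
parseReversed (x ∷ v) g nc with RG-∷ʳ⁻ (reverse v) (subst IsPartition (unfold-reverse x v) g)
... | g′ , 1≤x , x≤
  with parseReversed v g′ (λ (y , z , y<z , s) → nc (y , z , y<z ,
         subst (_ ⊆_) (sym (unfold-reverse x v)) (++⁺ʳ (x ∷ []) s)))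
...   | F , e with x ≤? blocks F
...     | yes x≤b = let e′    = trans (cong (_∷ʳ x) e) (sym (unfold-reverse x v))
                        G , e″ = append-old 0 F x 1≤x x≤b (nc ∘ subst Crossing e′)
                    in G , trans e″ e′
...     | no x≰b  = F ∷ʳ node [] , (begin
  wordOf 0 (F ∷ʳ node [])            ≡⟨ wordOf-++ 0 F (node [] ∷ []) ⟩
  wordOf 0 F ∷ʳ suc (blocks F)       ≡⟨ cong₂ _∷ʳ_ e (ℕ.≤-antisym (ℕ.≰⇒> x≰b) x≤′) ⟩
  reverse v ∷ʳ x                     ≡⟨ unfold-reverse x v ⟨
  reverse (x ∷ v)                    ∎)
  where
  open ≡-Reasoning
  x≤′ : x ≤ suc (blocks F)
  x≤′ = ℕ.≤-trans x≤ (s≤s (max-bound 0 (reverse v) z≤n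
          (λ m → proj₂ (wordOf-bounds 0 F (subst (_ ∈_) (sym e) m)))))

abstract
  parse : ∀ {w} → IsNonCrossing w → ∃[ F ] wordOf 0 F ≡ w
  parse {w} (g , avoids) =
    let F , e = parseReversed (reverse w) (subst IsPartition (sym (reverse-involutive w)) g)
                  (avoids ∘ Has⇒Contains ∘ Crossing⇒Has ∘ subst Crossing (reverse-involutive w))
    in F , trans e (reverse-involutive w)

wordOf-isNonCrossing : ∀ F → IsNonCrossing (wordOf 0 F)
wordOf-isNonCrossing F = wordOf-isPartition F , wordOf-avoids-1212 F

-- Containment in parts of a forest

Has-forest⁺ : ∀ r F {p} → Has (wordOf 0 F) p → Has (wordOf r F) p
Has-forest⁺ r F h = subst (λ w → Has w _) (sym (wordOf-shift r 0 F)) (Has-shift r (wordOf 0 F) h)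

Has-forest⁻ : ∀ r F {p} → Has (wordOf r F) p → Has (wordOf 0 F) p
Has-forest⁻ r F h = Has-unshift r (wordOf 0 F) (subst (λ w → Has w _) (wordOf-shift r 0 F) h)

Has-pattern⁻ : ∀ {w} r P → Has w (wordOf r P) → Has w (wordOf 0 P)
Has-pattern⁻ {w} r P h = Has-unshiftᵖ r (wordOf 0 P) (subst (Has w) (wordOf-shift r 0 P) h)

Has-++ˡ : ∀ F G {p} → Has (wordOf 0 F) p → Has (wordOf 0 (F ++ G)) p
Has-++ˡ F G h = subst (λ w → Has w _) (sym (wordOf-++ 0 F G)) (Has-mono (++⁺ʳ _ ⊆-refl) h)

Has-++ʳ : ∀ F G {p} → Has (wordOf 0 G) p → Has (wordOf 0 (F ++ G)) p
Has-++ʳ F G h = subst (λ w → Has w _) (sym (wordOf-++ 0 F G))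
  (Has-mono (++⁺ˡ (wordOf 0 F) ⊆-refl) (Has-forest⁺ (blocks F) G h))

concat-⊆-gapsOf : ∀ a r gs → wordOf r (concat gs) ⊆ gapsOf a r gs
concat-⊆-gapsOf a r []       = []
concat-⊆-gapsOf a r (θ ∷ gs) = subst (_⊆ gapsOf a r (θ ∷ gs)) (sym (wordOf-++ r θ (concat gs)))
  (++⁺ (⊆-refl {x = wordOf r θ}) (a ⊆∷ concat-⊆-gapsOf a (r + blocks θ) gs))

concat-∷ʳ-⊆-gapsOf : ∀ a r gs → gs ≢ [] → wordOf r (concat gs) ∷ʳ a ⊆ gapsOf a r gs
concat-∷ʳ-⊆-gapsOf a r []       ne = ⊥-elim (ne refl)
concat-∷ʳ-⊆-gapsOf a r (θ ∷ []) ne =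
  subst (λ F → wordOf r F ∷ʳ a ⊆ wordOf r θ ∷ʳ a) (sym (++-identityʳ θ)) ⊆-refl
concat-∷ʳ-⊆-gapsOf a r (θ ∷ gs@(_ ∷ _)) ne =
  subst (_⊆ gapsOf a r (θ ∷ gs))
    (trans (sym (++-assoc (wordOf r θ) _ _)) (cong (_∷ʳ a) (sym (wordOf-++ r θ (concat gs)))))
    (++⁺ (⊆-refl {x = wordOf r θ}) (a ⊆∷ concat-∷ʳ-⊆-gapsOf a (r + blocks θ) gs (λ ())))

Has-node : ∀ gs F {p} → Has (wordOf 0 (concat gs)) p → Has (wordOf 0 (node gs ∷ F)) p
Has-node gs F h = Has-mono (1 ⊆∷ ++⁺ʳ _ (concat-⊆-gapsOf 1 1 gs)) (Has-forest⁺ 1 (concat gs) h)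

-- Occurrences of 1[σ₁]1⋯1[σₖ]1 in a forest

-- The gaps must be nonempty even for σ = [], which is enclosed by two distinct 1s.
Covers : Word → List Forest → Set
Covers σ u = u ≢ [] × Has (wordOf 0 (concat u)) σ

Match : List Word → List Forest → Set
Match []       _ = ⊤
Match (σ ∷ σs)   = Covers σ ⋆ Match σs

Covers? : ∀ σ → Decidable (Covers σ)
Covers? σ []      = no λ (ne , _) → ne refl
Covers? σ (θ ∷ u) with Has? (wordOf 0 (concat (θ ∷ u))) σ
... | yes h = yes ((λ ()) , h)
... | no ¬h = no (¬h ∘ proj₂)

Match? : ∀ σs → Decidable (Match σs)
Match? []       u = yes tt
Match? (σ ∷ σs) = ⋆? (Covers? σ) (Match? σs)

Covers-leftClosed : ∀ {σ} → LeftClosed (Covers σ)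
Covers-leftClosed u v (ne , h) = nonempty u ,
  subst (λ F → Has (wordOf 0 F) _) (concat-++ u v) (Has-++ʳ (concat u) (concat v) h)
  where
  nonempty : ∀ u → u ++ v ≢ []
  nonempty [] e = ne e

Covers-rightClosed : ∀ {σ} → RightClosed (Covers σ)
Covers-rightClosed [] v (ne , h) = ⊥-elim (ne refl)
Covers-rightClosed (θ ∷ u) v (ne , h) = (λ ()) ,
  subst (λ F → Has (wordOf 0 F) _) (concat-++ (θ ∷ u) v) (Has-++ˡ (concat (θ ∷ u)) (concat v) h)

Match-leftClosed : ∀ σs → LeftClosed (Match σs)
Match-leftClosed []       u v m = tt
Match-leftClosed (σ ∷ σs) = ⋆-leftClosed Covers-leftClosed

Match⇒Covers : ∀ σs {u} → Match σs u → All (λ σ → Covers σ u) σs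
Match⇒Covers [] m = []
Match⇒Covers (σ ∷ σs) (u , v , refl , c , m) =
  Covers-rightClosed u v c ∷ All.map (Covers-leftClosed u v) (Match⇒Covers σs m)

mutual
  Hit : List Word → Forest → Set
  Hit σs []            = ⊥
  Hit σs (node gs ∷ F) = (Match σs gs ⊎ Hitᴳ σs gs) ⊎ Hit σs F

  Hitᴳ : List Word → List Forest → Set
  Hitᴳ σs []       = ⊥
  Hitᴳ σs (θ ∷ gs) = Hit σs θ ⊎ Hitᴳ σs gs

-- The cut is made at the first root letter behind the image of `s`. Because `s` avoids `a`, it uses
-- none of the earlier root letters and fits into the concatenated gaps. At least one gap is
-- consumed even for empty `s`, since `a` itself must be reached.
split-gapsOf : ∀ {a} r gs s {t} → a ≤ r → a ∉ s → s ++ a ∷ t ⊆ gapsOf a r gs →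
               ∃₂ λ u v → gs ≡ u ++ v × u ≢ [] × s ⊆ wordOf r (concat u) ×
                          t ⊆ gapsOf a (r + blocksᴳ u) v
split-gapsOf r [] []      a≤r n ()
split-gapsOf r [] (_ ∷ _) a≤r n ()
split-gapsOf {a} r (θ ∷ gs) s {t} a≤r n p with ⊆-++⁻ (wordOf r θ) p
... | s₁ , s₂ , e , p₁ , p₂ with prefix s s₁ e p₁
  where
  -- The first gap does not contain a.
  prefix : ∀ s s₁ → s ++ a ∷ t ≡ s₁ ++ s₂ → s₁ ⊆ wordOf r θ →
           ∃[ s′ ] s ≡ s₁ ++ s′ × s₂ ≡ s′ ++ a ∷ t
  prefix s       []       e q = s , refl , sym e
  prefix []      (x ∷ s₁) e q = ⊥-elim (∉-wordOf a≤r θ (∈-resp-⊆ q (here (∷-injectiveˡ e))))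
  prefix (y ∷ s) (x ∷ s₁) e q with prefix s s₁ (∷-injectiveʳ e) (∷ˡ⁻ q)
  ... | s′ , e₁ , e₂ = s′ , cong₂ _∷_ (∷-injectiveˡ e) e₁ , e₂
...   | s′ , refl , refl = extend s′ (n ∘ ∈-++⁺ʳ s₁) p₂
  where
  extend : ∀ s′ → a ∉ s′ → s′ ++ a ∷ t ⊆ a ∷ gapsOf a (r + blocks θ) gs →
           ∃₂ λ u v → θ ∷ gs ≡ u ++ v × u ≢ [] × (s₁ ++ s′) ⊆ wordOf r (concat u) ×
                      t ⊆ gapsOf a (r + blocksᴳ u) v
  extend [] n′ p₂ = θ ∷ [] , gs , refl , (λ ()) ,
    subst₂ _⊆_ (sym (++-identityʳ s₁)) (cong (wordOf r) (sym (++-identityʳ θ))) p₁ ,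
    subst (λ k → t ⊆ gapsOf a k gs) (cong (r +_) (sym (ℕ.+-identityʳ (blocks θ)))) (tail p₂)
    where
    tail : a ∷ t ⊆ a ∷ gapsOf a (r + blocks θ) gs → t ⊆ gapsOf a (r + blocks θ) gs
    tail (_ ∷ q)  = q
    tail (_ ⊆∷ q) = ∷ˡ⁻ q
  extend (c ∷ s′) n′ (e ∷ p₂)  = ⊥-elim (n′ (here (sym e)))
  extend (c ∷ s′) n′ (_ ⊆∷ p₂)
    with split-gapsOf (r + blocks θ) gs (c ∷ s′) (ℕ.≤-trans a≤r (ℕ.m≤m+n r _)) n′ p₂
  ... | u , v , e , ne , q , q′ = θ ∷ u , v , cong (θ ∷_) e , (λ ()) ,
    subst (_ ⊆_) (sym (wordOf-++ r θ (concat u))) (++⁺ p₁ q) ,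
    subst (λ k → t ⊆ gapsOf a k v) (ℕ.+-assoc r _ _) q′

MonoOn-⊆ : ∀ {p q g} → (∀ {x} → x ∈ p → x ∈ q) → MonoOn q g → MonoOn p g
MonoOn-⊆ i mono x∈p y∈p = mono (i x∈p) (i y∈p)

-- No pattern gap contains the letter 1, and `g` is injective on the pattern, so the image of a
-- pattern gap avoids the root letter. This permits cutting off one factor per pattern gap.
occurrence⇒Match : ∀ {g a} r r′ ps gs → MonoOn (1 ∷ gapsOf 1 r′ ps) g → g 1 ≡ a → 1 ≤ r′ → a ≤ r →
                   map g (gapsOf 1 r′ ps) ⊆ gapsOf a r gs → Match (map (wordOf 0) ps) gs
occurrence⇒Match r r′ [] gs mono e 1≤r′ a≤r s = tt
occurrence⇒Match {g} {a} r r′ (p ∷ ps) gs mono refl 1≤r′ a≤r s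
  with split-gapsOf r gs (map g (wordOf r′ p)) a≤r a∉
         (subst (_⊆ _) (map-++ g (wordOf r′ p) _) s)
  where
  a∉ : g 1 ∉ map g (wordOf r′ p)
  a∉ m with ∈-map⁻ g m
  ... | x , x∈ , e = ∉-wordOf 1≤r′ p
          (subst (_∈ _) (sym (MonoOn-injective mono (here refl) (there (∈-++⁺ˡ x∈)) e)) x∈)
... | u , v , refl , ne , q , q′ =
  u , v , refl ,
  (ne , Has-pattern⁻ r′ p (Has-forest⁻ r (concat u)
          (g , MonoOn-⊆ (λ m → there (∈-++⁺ˡ m)) mono , q))) ,
  occurrence⇒Match (r + blocksᴳ u) (r′ + blocks p) ps v
    (MonoOn-⊆ (λ m → there (∈-++⁺ʳ (wordOf r′ p) m)) mono) refl
    (ℕ.≤-trans 1≤r′ (ℕ.m≤m+n r′ _)) (ℕ.≤-trans a≤r (ℕ.m≤m+n r _)) q′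

Between : ℕ → ℕ → ℕ → Set
Between m n x = m < x × x ≤ n

-- The fields `low` and `range` are what gluing requires: pattern letters up to `r′`, among them 1,
-- go to the root letter, and the remaining ones go beyond all letters used by earlier factors,
-- which makes the glued map monotone.
record Embedding (a r r′ : ℕ) (ps gs : List Forest) : Set where
  field
    fun     : ℕ → ℕ
    low     : ∀ {x} → x ≤ r′ → fun x ≡ a
    range   : ∀ {x} → Between r′ (r′ + blocksᴳ ps) x → Between r (r + blocksᴳ gs) (fun x)
    mono    : ∀ {x y} → Between r′ (r′ + blocksᴳ ps) x → Between r′ (r′ + blocksᴳ ps) y →
              x < y → fun x < fun y
    sublist : map fun (gapsOf 1 r′ ps) ⊆ gapsOf a r gs

Match⇒embedding : ∀ a r r′ ps gs → 1 ≤ r′ → Match (map (wordOf 0) ps) gs → Embedding a r r′ ps gs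
Match⇒embedding a r r′ [] gs 1≤r′ m = record
  { fun = λ _ → a ; low = λ _ → refl
  ; range = λ (l , u) → ⊥-elim (ℕ.<⇒≱ l (subst (_ ≤_) (ℕ.+-identityʳ r′) u))
  ; mono = λ (l , u) _ _ → ⊥-elim (ℕ.<⇒≱ l (subst (_ ≤_) (ℕ.+-identityʳ r′) u))
  ; sublist = minimum _ }
Match⇒embedding a r r′ (p ∷ ps) gs 1≤r′ (u , v , refl , (u≢[] , g₀ , mono₀ , s₀) , m) = record
  { fun = g ; low = g-low ; range = λ b → g-range b ; mono = g-mono ; sublist = g-sub }
  where
  r″ = r′ + blocks p
  s  = r + blocksᴳ u
  ih = Match⇒embedding a s r″ ps v (ℕ.≤-trans 1≤r′ (ℕ.m≤m+n r′ _)) m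
  module IH = Embedding ih
  -- The substitution for the first pattern gap, moved from offset 0 to the offset `r′` of the
  -- pattern and the offset `r` of the word. It governs the letters between `r′` and `r″`; later
  -- letters are left to the embedding of the other gaps.
  g₁ : ℕ → ℕ
  g₁ x = g₀ (x ∸ r′) + r
  choose : ∀ {x} → Dec (x ≤ r′) → Dec (x ≤ r″) → ℕ → ℕ
  choose (yes _) _       x = a
  choose (no _)  (yes _) x = g₁ x
  choose (no _)  (no _)  x = IH.fun x
  g : ℕ → ℕ
  g x = choose (x ≤? r′) (x ≤? r″) x

  data Zone (x : ℕ) : ℕ → Set where
    lo  : x ≤ r′ → Zone x a
    mid : Between r′ r″ x → Zone x (g₁ x)
    hi  : r″ < x → Zone x (IH.fun x)

  zone : ∀ x → Zone x (g x)
  zone x = choice (x ≤? r′) (x ≤? r″)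
    where
    choice : ∀ d e → Zone x (choose d e x)
    choice (yes p) _       = lo p
    choice (no ¬p) (yes q) = mid (ℕ.≰⇒> ¬p , q)
    choice (no _)  (no ¬q) = hi (ℕ.≰⇒> ¬q)

  r′≤r″ : r′ ≤ r″
  r′≤r″ = ℕ.m≤m+n r′ _

  g-low : ∀ {x} → x ≤ r′ → g x ≡ a
  g-low {x} p with g x | zone x
  ... | _ | lo _        = refl
  ... | _ | mid (l , _) = ⊥-elim (ℕ.<⇒≱ l p)
  ... | _ | hi l        = ⊥-elim (ℕ.<⇒≱ l (ℕ.≤-trans p r′≤r″))

  g-mid : ∀ {x} → Between r′ r″ x → g x ≡ g₁ x
  g-mid {x} (l , u) with g x | zone x
  ... | _ | lo p  = ⊥-elim (ℕ.<⇒≱ l p)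
  ... | _ | mid _ = refl
  ... | _ | hi l′ = ⊥-elim (ℕ.<⇒≱ l′ u)

  g-hi : ∀ {x} → r″ < x → g x ≡ IH.fun x
  g-hi {x} l with g x | zone x
  ... | _ | lo p        = ⊥-elim (ℕ.<⇒≱ l (ℕ.≤-trans p r′≤r″))
  ... | _ | mid (_ , u) = ⊥-elim (ℕ.<⇒≱ l u)
  ... | _ | hi _        = refl

  mid-∈ : ∀ {x} → Between r′ r″ x → x ∸ r′ ∈ wordOf 0 p
  mid-∈ {x} (l , u) = wordOf-covers 0 p (ℕ.m<n⇒0<n∸m l) (ℕ.m≤n+o⇒m∸n≤o x r′ u)

  g₁-range : ∀ {x} → Between r′ r″ x → Between r s (g₁ x)
  g₁-range {x} b with wordOf-bounds 0 (concat u) (∈-resp-⊆ s₀ (∈-map⁺ g₀ (mid-∈ b)))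
  ... | l , u′ = ℕ.+-monoˡ-≤ r l ,
    subst (g₁ x ≤_) (trans (cong (_+ r) (blocks-concat u)) (ℕ.+-comm _ r)) (ℕ.+-monoˡ-≤ r u′)

  hi-between : ∀ {x} → r″ < x → x ≤ r′ + blocksᴳ (p ∷ ps) → Between r″ (r″ + blocksᴳ ps) x
  hi-between {x} l u′ = l , subst (x ≤_) (sym (ℕ.+-assoc r′ _ _)) u′

  s-offset : s + blocksᴳ v ≡ r + blocksᴳ (u ++ v)
  s-offset = trans (ℕ.+-assoc r _ _) (cong (r +_) (sym (blocksᴳ-++ u v)))

  g-range : ∀ {x} → Between r′ (r′ + blocksᴳ (p ∷ ps)) x → Between r (r + blocksᴳ (u ++ v)) (g x)
  g-range {x} (l , u′) with g x | zone x
  ... | _ | lo p  = ⊥-elim (ℕ.<⇒≱ l p)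
  ... | _ | mid b = let l₁ , u₁ = g₁-range b in
                    l₁ , ℕ.≤-trans u₁ (subst (s ≤_) s-offset (ℕ.m≤m+n s _))
  ... | _ | hi l′ = let l₁ , u₁ = IH.range (hi-between l′ u′) in
                    ℕ.≤-<-trans (ℕ.m≤m+n r _) l₁ , subst (IH.fun x ≤_) s-offset u₁

  g-mono : ∀ {x y} → Between r′ (r′ + blocksᴳ (p ∷ ps)) x → Between r′ (r′ + blocksᴳ (p ∷ ps)) y →
           x < y → g x < g y
  g-mono {x} {y} (l , u₁) (l′ , u₂) x<y with g x | zone x | g y | zone y
  ... | _ | lo p  | _ | _      = ⊥-elim (ℕ.<⇒≱ l p)
  ... | _ | mid _ | _ | lo p   = ⊥-elim (ℕ.<⇒≱ l′ p)
  ... | _ | hi _  | _ | lo p   = ⊥-elim (ℕ.<⇒≱ l′ p)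
  ... | _ | mid b | _ | mid b′ =
    ℕ.+-monoˡ-< r (mono₀ (mid-∈ b) (mid-∈ b′) (ℕ.∸-monoˡ-< x<y (ℕ.<⇒≤ l)))
  ... | _ | mid b | _ | hi h   =
    ℕ.≤-<-trans (proj₂ (g₁-range b)) (proj₁ (IH.range (hi-between h u₂)))
  ... | _ | hi h  | _ | mid b  = ⊥-elim (ℕ.<-asym x<y (ℕ.≤-<-trans (proj₂ b) h))
  ... | _ | hi h  | _ | hi h′  = IH.mono (hi-between h u₁) (hi-between h′ u₂) x<y

  first-gap : map g (wordOf r′ p) ⊆ wordOf r (concat u)
  first-gap = subst₂ _⊆_ (sym rewritten) (sym (wordOf-shift r 0 (concat u))) (map⁺ (_+ r) s₀)
    where
    open ≡-Reasoning
    rewritten : map g (wordOf r′ p) ≡ map (_+ r) (map g₀ (wordOf 0 p))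
    rewritten = begin
      map g (wordOf r′ p)
        ≡⟨ map-cong-local (All.tabulate (λ m → g-mid (wordOf-bounds r′ p m))) ⟩
      map g₁ (wordOf r′ p)
        ≡⟨ cong (map g₁) (wordOf-shift r′ 0 p) ⟩
      map g₁ (map (_+ r′) (wordOf 0 p))
        ≡⟨ map-∘ (wordOf 0 p) ⟨
      map (g₁ ∘ (_+ r′)) (wordOf 0 p)
        ≡⟨ map-cong (λ x → cong (λ y → g₀ y + r) (ℕ.m+n∸n≡m x r′)) (wordOf 0 p) ⟩
      map (λ x → g₀ x + r) (wordOf 0 p)
        ≡⟨ map-∘ (wordOf 0 p) ⟩
      map (_+ r) (map g₀ (wordOf 0 p)) ∎

  other-gaps : map g (gapsOf 1 r″ ps) ≡ map IH.fun (gapsOf 1 r″ ps)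
  other-gaps = map-cong-local (All.tabulate agree)
    where
    agree : ∀ {x} → x ∈ gapsOf 1 r″ ps → g x ≡ IH.fun x
    agree m with gapsOf-bounds 1 r″ ps m
    ... | inj₁ refl    = trans (g-low 1≤r′) (sym (IH.low (ℕ.≤-trans 1≤r′ r′≤r″)))
    ... | inj₂ (l , _) = g-hi l

  g-sub : map g (gapsOf 1 r′ (p ∷ ps)) ⊆ gapsOf a r (u ++ v)
  g-sub = subst₂ _⊆_
    (trans (++-assoc (map g (wordOf r′ p)) _ _)
      (trans (cong₂ (λ b w → map g (wordOf r′ p) ++ b ∷ w) (sym (g-low 1≤r′)) (sym other-gaps))
        (sym (map-++ g (wordOf r′ p) _))))
    (sym (gapsOf-++ a r u v))
    -- The 1 behind the first pattern gap is matched with the root letter closing the last gap of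
    -- `u`; it exists because `u` is nonempty.
    (++⁺ (⊆-trans (++⁺ first-gap ⊆-refl) (concat-∷ʳ-⊆-gapsOf a r u u≢[])) IH.sublist)

∷ʳ-split : ∀ {x : ℕ} w p {q} → w ∷ʳ x ≡ p ++ q → q ≡ [] ⊎ x ∈ q
∷ʳ-split w       []      refl = inj₂ (∈-insert w)
∷ʳ-split []      (_ ∷ []) {[]} e = inj₁ refl
∷ʳ-split []      (_ ∷ _ ∷ _) ()
∷ʳ-split (_ ∷ w) (_ ∷ p) e    = ∷ʳ-split w p (∷-injectiveʳ e)

-- The word begins and ends with `x`, so every proper cut leaves an `x` on both sides.
Bracketed-linked : ∀ x {s} → s ≡ [] ⊎ ∃[ w ] s ≡ w ∷ʳ x → Linked (x ∷ s)
Bracketed-linked x b [] q e = inj₁ refl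
Bracketed-linked x (inj₁ refl) (_ ∷ []) q e = inj₂ (inj₁ (sym (∷-injectiveʳ e)))
Bracketed-linked x (inj₂ (w , refl)) (_ ∷ p) q e with ∷ʳ-split w p (∷-injectiveʳ e)
... | inj₁ q≡[] = inj₂ (inj₁ q≡[])
... | inj₂ x∈q  = inj₂ (inj₂ (x , here (∷-injectiveˡ e) , x∈q))

treeWord : List Forest → Word
treeWord ps = 1 ∷ gapsOf 1 1 ps

treeWord-linked : ∀ g ps → Linked (map g (treeWord ps))
treeWord-linked g ps with gapsOf-last 1 1 ps
... | inj₁ refl    = Bracketed-linked (g 1) (inj₁ refl)
... | inj₂ (w , e) = Bracketed-linked (g 1) (inj₂ (map g w , trans (cong (map g) e) (map-++ g w _)))

module _ (ps : List Forest) where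

  private
    σs = map (wordOf 0) ps

  module _ {g : ℕ → ℕ} (mono : MonoOn (treeWord ps) g) where

    private
      least : ∀ {x} → x ∈ map g (treeWord ps) → g 1 ≤ x
      least m with ∈-map⁻ g m
      ... | _ , here refl , refl = ℕ.≤-refl
      ... | x , there m′ , refl with gapsOf-bounds 1 1 ps m′
      ...   | inj₁ refl    = ℕ.≤-refl
      ...   | inj₂ (l , _) = ℕ.<⇒≤ (mono (here refl) (there m′) l)

    mutual
      occurrence⇒Hit : ∀ r F → map g (treeWord ps) ⊆ wordOf r F → Hit σs F
      occurrence⇒Hit r (node gs ∷ F) s
        with Linked-⊆-++ (suc r ∷ gapsOf (suc r) (suc r) gs) (treeWord-linked g ps)
               (tree-apart r gs F) s
      ... | inj₂ q = inj₂ (occurrence⇒Hit (suc r + blocksᴳ gs) F q)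
      ... | inj₁ (e ∷ q) = inj₁ (inj₁ (occurrence⇒Match (suc r) 1 ps gs mono e ℕ.≤-refl ℕ.≤-refl q))
      ... | inj₁ (_ ⊆∷ q) with g 1 ≟ suc r
      -- The occurrence starts at a later copy of the root letter; what follows its first letter
      -- still lies in the gaps.
      ...   | yes e =
        inj₁ (inj₁ (occurrence⇒Match (suc r) 1 ps gs mono e ℕ.≤-refl ℕ.≤-refl (∷ˡ⁻ q)))
      ...   | no ne = inj₁ (inj₂ (occurrence⇒Hitᴳ (suc r) (suc r) gs ℕ.≤-refl root∉ q))
        where
        root∉ : suc r ∉ map g (treeWord ps)
        root∉ m with gapsOf-bounds (suc r) (suc r) gs (∈-resp-⊆ q (here refl))
        ... | inj₁ e       = ne e
        ... | inj₂ (l , _) = ℕ.<⇒≱ l (least m)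

      occurrence⇒Hitᴳ : ∀ a r gs → a ≤ r → a ∉ map g (treeWord ps) →
                        map g (treeWord ps) ⊆ gapsOf a r gs → Hitᴳ σs gs
      occurrence⇒Hitᴳ a r (θ ∷ gs) a≤r a∉ s
        with Linked-⊆-++ (wordOf r θ) (treeWord-linked g ps)
               (wordOf-apart r θ {gs = gs} a≤r ℕ.≤-refl) s
      ... | inj₁ q = inj₁ (occurrence⇒Hit r θ q)
      ... | inj₂ q = inj₂
        (occurrence⇒Hitᴳ a (r + blocks θ) gs (ℕ.≤-trans a≤r (ℕ.m≤m+n r _)) a∉ (⊆-∷⁻ a∉ q))

  Match⇒Has : ∀ gs → Match σs gs → Has (treeWord gs) (treeWord ps)
  Match⇒Has gs m = fun , mono′ , low ℕ.≤-refl ∷ sublist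
    where
    open Embedding (Match⇒embedding 1 1 1 ps gs ℕ.≤-refl m)
    bounds : ∀ {x} → x ∈ treeWord ps → x ≡ 1 ⊎ Between 1 (1 + blocksᴳ ps) x
    bounds (here e)   = inj₁ e
    bounds (there m′) = gapsOf-bounds 1 1 ps m′
    mono′ : MonoOn (treeWord ps) fun
    mono′ {y = y} x∈ y∈ x<y with bounds x∈ | bounds y∈
    ... | inj₁ refl | inj₁ refl = ⊥-elim (ℕ.<-irrefl refl x<y)
    ... | inj₁ refl | inj₂ b    = subst (_< fun y) (sym (low ℕ.≤-refl)) (proj₁ (range b))
    ... | inj₂ b    | inj₁ refl = ⊥-elim (ℕ.<-asym x<y (proj₁ b))
    ... | inj₂ b    | inj₂ b′   = mono b b′ x<y

  mutual
    Hit⇒Has : ∀ F → Hit σs F → Has (wordOf 0 F) (treeWord ps)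
    Hit⇒Has (node gs ∷ F) (inj₁ (inj₁ m)) = Has-mono (refl ∷ ++⁺ʳ _ ⊆-refl) (Match⇒Has gs m)
    Hit⇒Has (node gs ∷ F) (inj₁ (inj₂ h)) = Has-node gs F (Hitᴳ⇒Has gs h)
    Hit⇒Has (node gs ∷ F) (inj₂ h) = Has-++ʳ (node gs ∷ []) F (Hit⇒Has F h)

    Hitᴳ⇒Has : ∀ gs → Hitᴳ σs gs → Has (wordOf 0 (concat gs)) (treeWord ps)
    Hitᴳ⇒Has (θ ∷ gs) (inj₁ h) = Has-++ˡ θ (concat gs) (Hit⇒Has θ h)
    Hitᴳ⇒Has (θ ∷ gs) (inj₂ h) = Has-++ʳ θ (concat gs) (Hitᴳ⇒Has gs h)

  Has⇒Hit : ∀ F → Has (wordOf 0 F) (treeWord ps) → Hit σs F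
  Has⇒Hit F (g , mono , s) = occurrence⇒Hit mono 0 F s

-- Bracket notation

Unique-⊆-length : {xs ys : Word} → Unique xs → (∀ {x} → x ∈ xs → x ∈ ys) → length xs ≤ length ys
Unique-⊆-length []         i = z≤n
Unique-⊆-length {x ∷ xs} {ys} (px ∷ u) i with ∈-∃++ (i (here refl))
... | as , bs , refl = subst (suc (length xs) ≤_) (sym len) (s≤s (Unique-⊆-length u i′))
  where
  len : length (as ++ x ∷ bs) ≡ suc (length (as ++ bs))
  len = trans (length-++ as) (trans (ℕ.+-suc (length as) _) (cong suc (sym (length-++ as))))
  i′ : ∀ {y} → y ∈ xs → y ∈ as ++ bs
  i′ y∈xs with ∈-++⁻ as (i (there y∈xs))
  ... | inj₁ m           = ∈-++⁺ˡ m
  ... | inj₂ (here e)    = ⊥-elim (All.lookup px y∈xs (sym e))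
  ... | inj₂ (there m)   = ∈-++⁺ʳ as m

-- The invariant under which `#symbols` equals `r`, so that the shifts of the bracket notation
-- become the offsets of `wordOf`.
Exact : ℕ → Word → Set
Exact r w = ∀ {x} → x ∈ w ⇔ Between 0 r x

∈-range⁺ : ∀ {r x} → Between 0 r x → x ∈ applyUpTo suc r
∈-range⁺ {x = suc x} (_ , x<r) = ∈-applyUpTo⁺ suc x<r

∈-range⁻ : ∀ {r x} → x ∈ applyUpTo suc r → Between 0 r x
∈-range⁻ m with ∈-applyUpTo⁻ suc m
... | i , i<r , refl = s≤s z≤n , i<r

Exact⇒#symbols : ∀ {r} w → Exact r w → #symbols w ≡ r
Exact⇒#symbols {r} w ex = trans
  (ℕ.≤-antisym
    (Unique-⊆-length (deduplicate-! _≟_ w)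
      (λ m → ∈-range⁺ (to ex (∈-deduplicate⁻ _≟_ w m))))
    (Unique-⊆-length (applyUpTo⁺₁ suc r (λ i<j _ e → ℕ.<⇒≢ i<j (ℕ.suc-injective e)))
      (λ m → ∈-deduplicate⁺ _≟_ (from ex (∈-range⁻ m)))))
  (length-applyUpTo suc r)

Exact-[] : Exact 0 []
Exact-[] = mk⇔ (λ ()) (λ (l , u) → ⊥-elim (ℕ.<⇒≱ l u))

Exact-++ : ∀ {r w} F → Exact r w → Exact (r + blocks F) (w ++ wordOf r F)
Exact-++ {r} {w} F ex {x} = mk⇔ bounds covers
  where
  bounds : x ∈ w ++ wordOf r F → Between 0 (r + blocks F) x
  bounds m with ∈-++⁻ w m
  ... | inj₁ m′ = let l , u = to ex m′ in l , ℕ.≤-trans u (ℕ.m≤m+n r _)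
  ... | inj₂ m′ = let l , u = wordOf-bounds r F m′ in ℕ.≤-<-trans z≤n l , u
  covers : Between 0 (r + blocks F) x → x ∈ w ++ wordOf r F
  covers (l , u) with x ℕ.≤? r
  ... | yes x≤r = ∈-++⁺ˡ (from ex (l , x≤r))
  ... | no x≰r  = ∈-++⁺ʳ w (wordOf-covers r F (ℕ.≰⇒> x≰r) u)

Exact-∷ʳ : ∀ {r w a} → Exact r w → Between 0 r a → Exact r (w ∷ʳ a)
Exact-∷ʳ {r} {w} {a} ex b {x} = mk⇔ bounds (∈-++⁺ˡ ∘ from ex)
  where
  bounds : x ∈ w ∷ʳ a → Between 0 r x
  bounds m with ∈-++⁻ w m
  ... | inj₁ m′          = to ex m′
  ... | inj₂ (here refl) = b

#symbols-wordOf : ∀ F → #symbols (wordOf 0 F) ≡ blocks F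
#symbols-wordOf F = Exact⇒#symbols (wordOf 0 F) (Exact-++ F Exact-[])

⟦⟧-wordOf : ∀ {r w} F → Exact r w → w ⟦ wordOf 0 F ⟧ ≡ w ++ wordOf r F
⟦⟧-wordOf {r} {w} F ex = cong (w ++_) (trans
  (cong (λ k → map (_+ k) (wordOf 0 F)) (Exact⇒#symbols w ex)) (sym (wordOf-shift r 0 F)))

interleave-from : ∀ {r w} ps → Exact r w → 1 ≤ r →
  evalFrom w (concatMap (λ σ → bracket σ ∷ letter 1 ∷ []) (map (wordOf 0) ps)) ≡ w ++ gapsOf 1 r ps
interleave-from []       ex 1≤r = sym (++-identityʳ _)
interleave-from {r} {w} (p ∷ ps) ex 1≤r
  rewrite ⟦⟧-wordOf p ex = trans
  (interleave-from ps (Exact-∷ʳ (Exact-++ p ex) (s≤s z≤n , ℕ.≤-trans 1≤r (ℕ.m≤m+n r _)))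
    (ℕ.≤-trans 1≤r (ℕ.m≤m+n r _)))
  (trans (++-assoc (w ++ wordOf r p) _ _) (++-assoc w _ _))

interleave1-treeWord : ∀ ps → interleave1 (map (wordOf 0) ps) ≡ treeWord ps
interleave1-treeWord ps = interleave-from ps ex ℕ.≤-refl
  where
  ex : Exact 1 (1 ∷ [])
  ex = mk⇔ (λ { (here refl) → s≤s z≤n , ℕ.≤-refl })
           (λ (l , u) → here (ℕ.≤-antisym u l))

eval-brackets : ∀ {r w} Fs → Exact r w →
                evalFrom w (map bracket (map (wordOf 0) Fs)) ≡ w ++ wordOf r (concat Fs)
eval-brackets         []       ex = sym (++-identityʳ _)
eval-brackets {r} {w} (F ∷ Fs) ex
  rewrite ⟦⟧-wordOf F ex = trans (eval-brackets Fs (Exact-++ F ex))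
  (trans (++-assoc w _ _) (cong (w ++_) (sym (wordOf-++ r F (concat Fs)))))

-- Components

RG-positive : ∀ {m w x} → RestrictedGrowth m w → x ∈ w → 1 ≤ x
RG-positive (cons l _ _) (here refl) = l
RG-positive (cons _ _ g) (there m)   = RG-positive g m

Connected⇒tree : ∀ F → Connected (wordOf 0 F) → F ≡ [] ⊎ ∃[ gs ] F ≡ [ node gs ]
Connected⇒tree []                con = inj₁ refl
Connected⇒tree (node gs ∷ [])    con = inj₂ (gs , refl)
Connected⇒tree (t@(node _) ∷ G@(node _ ∷ _)) con = ⊥-elim (con
  (wordOf 0 [ t ] , wordOf 0 G , wordOf-isPartition [ t ] , wordOf-isPartition G , (λ ()) , (λ ()) ,
   trans (wordOf-++ 0 [ t ] G) (sym (⟦⟧-wordOf G (Exact-++ [ t ] Exact-[])))))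

wordOf-tree : ∀ gs → wordOf 0 [ node gs ] ≡ treeWord gs
wordOf-tree gs = cong (1 ∷_) (++-identityʳ _)

map-≡[] : ∀ {f : ℕ → ℕ} w → map f w ≡ [] → w ≡ []
map-≡[] [] _ = refl

#symbols-bound : ∀ {w x} → IsNonCrossing w → x ∈ w → x ≤ #symbols w
#symbols-bound {w} {x} nc m = bound (parse nc)
  where
  bound : ∃[ A ] wordOf 0 A ≡ w → x ≤ #symbols w
  bound (A , refl) = subst (x ≤_) (sym (#symbols-wordOf A)) (proj₂ (wordOf-bounds 0 A m))

-- A letter common to both parts would be at most `#symbols α` as a letter of `α`, yet larger as a
-- shifted letter of `β`. The first bound comes from parsing `α`, which inherits the avoidance of
-- 1212.
Linked⇒Connected : ∀ {w} → Linked w → Avoids w p1212 → Connected w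
Linked⇒Connected linked avoids (α , β , gα , gβ , α≢[] , β≢[] , refl)
  with linked α (map (_+ #symbols α) β) refl
... | inj₁ α≡[]      = α≢[] α≡[]
... | inj₂ (inj₁ e)  = β≢[] (map-≡[] β e)
... | inj₂ (inj₂ (c , c∈α , c∈β)) with ∈-map⁻ _ c∈β
...   | x , x∈β , refl = ℕ.<⇒≱ (ℕ.m<n+m (#symbols α) (RG-positive gβ x∈β))
  (#symbols-bound (gα , avoids ∘ Has⇒Contains ∘ Has-mono (++⁺ʳ _ ⊆-refl) ∘ Contains⇒Has) c∈α)

tree-linked : ∀ gs → Linked (wordOf 0 [ node gs ])
tree-linked gs = subst Linked (trans (map-id _) (sym (wordOf-tree gs))) (treeWord-linked id gs)

tree-isComponent : ∀ t → IsComponent (wordOf 0 [ t ])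
tree-isComponent t@(node gs) =
  wordOf-isPartition [ t ] , (λ ()) , Linked⇒Connected (tree-linked gs) (wordOf-avoids-1212 [ t ])

HasComponents-length : ∀ F → HasComponents (wordOf 0 F) (length F)
HasComponents-length F =
  map (wordOf 0) (map [_] F) , trans (length-map (wordOf 0) (map [_] F)) (length-map [_] F) ,
  components F ,
  trans (cong (wordOf 0) (sym (concat-map-[_] F))) (sym (eval-brackets (map [_] F) Exact-[]))
  where
  components : ∀ F → All IsComponent (map (wordOf 0) (map [_] F))
  components []      = []
  components (t ∷ F) = tree-isComponent t ∷ components F

evalFrom-⊆ : ∀ w σs → w ⊆ evalFrom w (map bracket σs)
evalFrom-⊆ w []       = ⊆-refl
evalFrom-⊆ w (σ ∷ σs) = ⊆-trans (++⁺ʳ _ ⊆-refl) (evalFrom-⊆ (w ⟦ σ ⟧) σs)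

brackets-avoid : ∀ {p} w σs → ¬ Has (evalFrom w (map bracket σs)) p → All (λ σ → ¬ Has σ p) σs
brackets-avoid w []       n = []
brackets-avoid w (σ ∷ σs) n =
  (λ h → n (Has-mono (⊆-trans (++⁺ˡ w ⊆-refl) (evalFrom-⊆ (w ⟦ σ ⟧) σs))
                  (Has-shift (#symbols w) σ h)))
  ∷ brackets-avoid (w ⟦ σ ⟧) σs n

components⇒trees : ∀ {σs} → All IsComponent σs → All (λ σ → ¬ Has σ p1212) σs →
                   ∃[ F ] σs ≡ map (wordOf 0) (map [_] F)
components⇒trees [] [] = [] , refl
components⇒trees ((g , ne , con) ∷ cs) (n ∷ ns)
  with parse (g , n ∘ Contains⇒Has) | components⇒trees cs ns
... | A , refl | F , refl with Connected⇒tree A con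
...   | inj₁ refl        = ⊥-elim (ne refl)
...   | inj₂ (gs , refl) = node gs ∷ F , refl

-- Each component inherits the avoidance of 1212, so it is the word of a single tree. The components
-- thus spell a forest, which `wordOf-injective` identifies with `F`.
HasComponents⇒length : ∀ F {m} → HasComponents (wordOf 0 F) m → m ≡ length F
HasComponents⇒length F (σs , refl , cs , e)
  with components⇒trees cs (brackets-avoid [] σs
         (λ h → wordOf-avoids-1212 F (Has⇒Contains (subst (λ w → Has w p1212) (sym e) h))))
... | G , refl = trans (length-map (wordOf 0) (map [_] G)) (trans (length-map [_] G)
  (cong length (wordOf-injective 0 G F (trans (cong (wordOf 0) (sym (concat-map-[_] G)))
    (trans (sym (eval-brackets (map [_] G) Exact-[])) (sym e))))))

HasComponents-cong : ∀ F G → length F ≡ length G → ∀ m →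
                     HasComponents (wordOf 0 F) m ⇔ HasComponents (wordOf 0 G) m
HasComponents-cong F G e m = mk⇔ (transfer F G e) (transfer G F (sym e))
  where
  transfer : ∀ F G → length F ≡ length G →
             HasComponents (wordOf 0 F) m → HasComponents (wordOf 0 G) m
  transfer F G e h = subst (HasComponents (wordOf 0 G))
    (sym (trans (HasComponents⇒length F h) e)) (HasComponents-length G)

-- Invariance of Covers under reversal

blocksᴳ-sum : ∀ gs → blocksᴳ gs ≡ sum (map blocks gs)
blocksᴳ-sum []       = refl
blocksᴳ-sum (θ ∷ gs) = cong (blocks θ +_) (blocksᴳ-sum gs)

blocksᴳ-↭ : ∀ {gs hs} → gs ↭ hs → blocksᴳ gs ≡ blocksᴳ hs
blocksᴳ-↭ {gs} {hs} p =
  trans (blocksᴳ-sum gs) (trans (sum-↭ (↭.map⁺ blocks p)) (sym (blocksᴳ-sum hs)))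

length-wordOf : ∀ r F → length (wordOf r F) ≡ length (wordOf 0 F)
length-wordOf r F = trans (cong length (wordOf-shift r 0 F)) (length-map (_+ r) (wordOf 0 F))

length-gapsOf : ∀ a r gs → length (gapsOf a r gs) ≡ sum (map (λ θ → suc (length (wordOf 0 θ))) gs)
length-gapsOf a r []       = refl
length-gapsOf a r (θ ∷ gs) = trans (length-++ (wordOf r θ)) (trans (ℕ.+-suc _ _)
  (cong suc (cong₂ _+_ (length-wordOf r θ) (length-gapsOf a (r + blocks θ) gs))))

length-gapsOf-↭ : ∀ a r {gs hs} → gs ↭ hs → length (gapsOf a r gs) ≡ length (gapsOf a r hs)
length-gapsOf-↭ a r {gs} {hs} p = trans (length-gapsOf a r gs)
  (trans (sum-↭ (↭.map⁺ _ p)) (sym (length-gapsOf a r hs)))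

ascending : ℕ → ℕ → Word
ascending r zero    = []
ascending r (suc n) = suc r ∷ ascending (suc r) n

ascending-mono : ∀ r {m n} → m ≤ n → ascending r m ⊆ ascending r n
ascending-mono r z≤n       = minimum _
ascending-mono r (s≤s m≤n) = refl ∷ ascending-mono (suc r) m≤n

length-ascending : ∀ r n → length (ascending r n) ≡ n
length-ascending r zero    = refl
length-ascending r (suc n) = cong suc (length-ascending (suc r) n)

ascending-+ : ∀ r m n → ascending r (m + n) ≡ ascending r m ++ ascending (r + m) n
ascending-+ r zero    n = cong (λ k → ascending k n) (sym (ℕ.+-identityʳ r))
ascending-+ r (suc m) n = cong (suc r ∷_) (trans (ascending-+ (suc r) m n)
  (cong (λ k → ascending (suc r) m ++ ascending k n) (sym (ℕ.+-suc r m))))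

mutual
  -- The first occurrences of the letters come in increasing order. Hence a forest with at least n
  -- blocks contains the pattern of n singletons.
  ascending-⊆-wordOf : ∀ r F → ascending r (blocks F) ⊆ wordOf r F
  ascending-⊆-wordOf r []            = []
  ascending-⊆-wordOf r (node gs ∷ F) = refl ∷
    subst (_⊆ gapsOf (suc r) (suc r) gs ++ wordOf (suc r + blocksᴳ gs) F)
      (sym (ascending-+ (suc r) (blocksᴳ gs) (blocks F)))
      (++⁺ (ascending-⊆-gapsOf (suc r) (suc r) gs) (ascending-⊆-wordOf (suc r + blocksᴳ gs) F))

  ascending-⊆-gapsOf : ∀ a r gs → ascending r (blocksᴳ gs) ⊆ gapsOf a r gs
  ascending-⊆-gapsOf a r []       = []
  ascending-⊆-gapsOf a r (θ ∷ gs) =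
    subst (_⊆ gapsOf a r (θ ∷ gs)) (sym (ascending-+ r (blocks θ) (blocksᴳ gs)))
      (++⁺ (ascending-⊆-wordOf r θ) (a ⊆∷ ascending-⊆-gapsOf a (r + blocks θ) gs))

Unique⇒ascending : ∀ r F → Unique (wordOf r F) → wordOf r F ≡ ascending r (blocks F)
Unique⇒ascending r []                  u        = refl
Unique⇒ascending r (node [] ∷ F)       (_ ∷ u)  =
  cong (suc r ∷_) (trans (cong (λ k → wordOf (suc k) F) (ℕ.+-identityʳ r))
    (Unique⇒ascending (suc r) F (subst (λ k → Unique (wordOf (suc k) F)) (ℕ.+-identityʳ r) u)))
Unique⇒ascending r (node (θ ∷ gs) ∷ F) (px ∷ _) =
  ⊥-elim (All.lookup px (∈-++⁺ˡ (∈-++⁺ʳ (wordOf (suc r) θ) (here refl))) refl)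

Unique-map : ∀ {p g} → MonoOn p g → Unique p → Unique (map g p)
Unique-map {[]}    mono []       = []
Unique-map {x ∷ p} {g} mono (px ∷ u) = All.tabulate fresh ∷ Unique-map (MonoOn-⊆ there mono) u
  where
  fresh : ∀ {y} → y ∈ map g p → g x ≢ y
  fresh m e with ∈-map⁻ g m
  ... | z , z∈p , refl = All.lookup px z∈p (MonoOn-injective mono (here refl) (there z∈p) e)

Has-Unique⇒≤ : ∀ F {σ} → Unique σ → Has (wordOf 0 F) σ → length σ ≤ blocks F
Has-Unique⇒≤ F {σ} u (g , mono , s) = subst₂ _≤_ (length-map g σ) (length-applyUpTo suc (blocks F))
  (Unique-⊆-length (Unique-map mono u) (λ m → ∈-range⁺ (wordOf-bounds 0 F (∈-resp-⊆ s m))))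

Linked-⊆-concat : ∀ {s} r gs → Linked s → s ≢ [] → s ⊆ wordOf r (concat gs) →
                  ∃₂ λ θ k → θ ∈ gs × s ⊆ wordOf k θ
Linked-⊆-concat r [] linked s≢[] [] = ⊥-elim (s≢[] refl)
Linked-⊆-concat {s} r (θ ∷ gs) linked s≢[] p
  with Linked-⊆-++ (wordOf r θ) linked
         (λ m m′ → ∉-wordOf (proj₂ (wordOf-bounds r θ m)) (concat gs) m′)
         (subst (s ⊆_) (wordOf-++ r θ (concat gs)) p)
... | inj₁ q = θ , r , here refl , q
... | inj₂ q with Linked-⊆-concat (r + blocks θ) gs linked s≢[] q
...   | θ′ , k , m , q′ = θ′ , k , there m , q′

Has-concat : ∀ {σ θ} gs → θ ∈ gs → Has (wordOf 0 θ) σ → Has (wordOf 0 (concat gs)) σ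
Has-concat (θ ∷ gs) (here refl) h = Has-++ˡ θ (concat gs) h
Has-concat (θ ∷ gs) (there m)   h = Has-++ʳ θ (concat gs) (Has-concat gs m h)

ReversalInvariant : Word → Set
ReversalInvariant σ = ∀ gs → Has (wordOf 0 (concat gs)) σ → Has (wordOf 0 (concat (reverse gs))) σ

[]-reversalInvariant : ReversalInvariant []
[]-reversalInvariant gs h = id , (λ ()) , minimum _

-- A connected pattern is a tree word, so each occurrence lies inside a single gap, and reversal
-- keeps the gaps. A pattern with only singleton blocks is 12⋯n, whose containment only asks for n
-- blocks, and reversal keeps their number.
reversalInvariant : ∀ {σ} → IsNonCrossing σ → σ ≡ [] ⊎ Connected σ ⊎ OnlySingletonBlocks σ →
                    ReversalInvariant σ
reversalInvariant nc (inj₁ refl) = []-reversalInvariant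
reversalInvariant nc (inj₂ (inj₁ con)) with parse nc
... | P , refl with Connected⇒tree P con
...   | inj₁ refl        = []-reversalInvariant
...   | inj₂ (ps , refl) = invariant
  where
  invariant : ReversalInvariant (wordOf 0 [ node ps ])
  invariant gs (g , mono , s)
    with Linked-⊆-concat 0 gs
           (subst (Linked ∘ map g) (sym (wordOf-tree ps)) (treeWord-linked g ps)) (λ ()) s
  ... | θ , k , m , q = Has-concat (reverse gs) (Any-resp-↭ (↭-sym (↭-reverse gs)) m)
                          (Has-forest⁻ k θ (g , mono , q))
reversalInvariant nc (inj₂ (inj₂ u)) with parse nc
... | P , refl = invariant
  where
  invariant : ReversalInvariant (wordOf 0 P)
  invariant gs h = id , (λ _ _ x<y → x<y) , subst (_⊆ W) (sym (map-id _)) (subst (_⊆ W) (sym asc)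
    (⊆-trans (ascending-mono 0 b≤) (ascending-⊆-wordOf 0 (concat (reverse gs)))))
    where
    W = wordOf 0 (concat (reverse gs))
    asc : wordOf 0 P ≡ ascending 0 (blocks P)
    asc = Unique⇒ascending 0 P u
    b≤ : blocks P ≤ blocks (concat (reverse gs))
    b≤ = subst₂ _≤_ (trans (cong length asc) (length-ascending 0 _))
      (trans (blocks-concat gs) (trans (blocksᴳ-↭ (↭-sym (↭-reverse gs)))
        (sym (blocks-concat (reverse gs)))))
      (Has-Unique⇒≤ (concat gs) u h)

open Equivalence using (to; from)
open Rearrangement using (fun; inv; fun-inv; inv-fun; fun-↭)

-- The bijection

Full : List Word → Forest → Set
Full σs F = All (Has (wordOf 0 F)) σs

Full-node : ∀ {σs} gs F → Full σs (concat gs) → Full σs (node gs ∷ F)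
Full-node gs F = All.map (Has-node gs F)

Full-++ˡ : ∀ {σs} F G → Full σs F → Full σs (F ++ G)
Full-++ˡ F G = All.map (Has-++ˡ F G)

Full-++ʳ : ∀ {σs} F G → Full σs G → Full σs (F ++ G)
Full-++ʳ F G = All.map (Has-++ʳ F G)

Hitᴳ-↭ : ∀ σs {gs hs} → gs ↭ hs → Hitᴳ σs gs → Hitᴳ σs hs
Hitᴳ-↭ σs ↭.refl                h               = h
Hitᴳ-↭ σs (↭.prep _ p)          (inj₁ h)        = inj₁ h
Hitᴳ-↭ σs (↭.prep _ p)          (inj₂ h)        = inj₂ (Hitᴳ-↭ σs p h)
Hitᴳ-↭ σs (↭.swap _ _ p)        (inj₁ h)        = inj₂ (inj₁ h)
Hitᴳ-↭ σs (↭.swap _ _ p)        (inj₂ (inj₁ h)) = inj₁ h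
Hitᴳ-↭ σs (↭.swap _ _ p)        (inj₂ (inj₂ h)) = inj₂ (inj₂ (Hitᴳ-↭ σs p h))
Hitᴳ-↭ σs (↭.trans p q)     h               = Hitᴳ-↭ σs q (Hitᴳ-↭ σs p h)

record GapBijection (σs σs′ : List Word) : Set where
  field
    φ       : Rearrangement {Forest}
    φ-Match : ∀ gs → Match σs gs ⇔ Match σs′ (fun φ gs)
    -- What φ changes keeps all the σ, so that applying φ inside the gaps of a
    -- node does not affect which of the σ these gaps cover.
    φ-full  : ∀ gs → fun φ gs ≡ gs ⊎ (Full σs (concat gs) × Full σs (concat (fun φ gs)))

module Recursion {σs σs′ : List Word} (β : GapBijection σs σs′) where

  open GapBijection β

  mutual
    -- The recursion is bottom-up: `φ` sees gaps that are already transformed. A preimage is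
    -- therefore found from the top, undoing `φ` before descending.
    f : Forest → Forest
    f []            = []
    f (node gs ∷ F) = node (fun φ (fᴳ gs)) ∷ f F

    fᴳ : List Forest → List Forest
    fᴳ []       = []
    fᴳ (θ ∷ gs) = f θ ∷ fᴳ gs

  length-f : ∀ F → length (f F) ≡ length F
  length-f []            = refl
  length-f (node gs ∷ F) = cong suc (length-f F)

  mutual
    f-injective : ∀ F G → f F ≡ f G → F ≡ G
    f-injective []            []             e = refl
    f-injective []            (node _ ∷ _)   ()
    f-injective (node _ ∷ _)  []             ()
    f-injective (node gs ∷ F) (node gs′ ∷ G) e with ∷-injective e
    ... | e₁ , e₂ = cong₂ (λ hs H → node hs ∷ H)
      (fᴳ-injective gs gs′ (trans (sym (inv-fun φ _))
        (trans (cong (inv φ) (node-injective e₁)) (inv-fun φ _))))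
      (f-injective F G e₂)
      where
      node-injective : ∀ {gs hs} → node gs ≡ node hs → gs ≡ hs
      node-injective refl = refl

    fᴳ-injective : ∀ gs hs → fᴳ gs ≡ fᴳ hs → gs ≡ hs
    fᴳ-injective []       []       e = refl
    fᴳ-injective (θ ∷ gs) (η ∷ hs) e with ∷-injective e
    ... | e₁ , e₂ = cong₂ _∷_ (f-injective θ η e₁) (fᴳ-injective gs hs e₂)

  mutual
    length-word-f : ∀ r F → length (wordOf r (f F)) ≡ length (wordOf r F)
    length-word-f r []            = refl
    length-word-f r (node gs ∷ F) = cong suc (begin
      length (gapsOf a a hs ++ wordOf (a + blocksᴳ hs) (f F))
        ≡⟨ length-++ (gapsOf a a hs) ⟩
      length (gapsOf a a hs) + length (wordOf (a + blocksᴳ hs) (f F))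
        ≡⟨ cong₂ _+_ (trans (length-gapsOf-↭ a a (fun-↭ φ (fᴳ gs))) (length-gaps-f a a gs))
             (trans (length-wordOf (a + blocksᴳ hs) (f F)) (trans (length-word-f 0 F)
               (sym (length-wordOf (a + blocksᴳ gs) F)))) ⟩
      length (gapsOf a a gs) + length (wordOf (a + blocksᴳ gs) F)
        ≡⟨ sym (length-++ (gapsOf a a gs)) ⟩
      length (gapsOf a a gs ++ wordOf (a + blocksᴳ gs) F) ∎)
      where
      open ≡-Reasoning
      a  = suc r
      hs = fun φ (fᴳ gs)

    length-gaps-f : ∀ a r gs → length (gapsOf a r (fᴳ gs)) ≡ length (gapsOf a r gs)
    length-gaps-f a r []       = refl
    length-gaps-f a r (θ ∷ gs) = begin
      length (wordOf r (f θ) ++ a ∷ gapsOf a (r + blocks (f θ)) (fᴳ gs))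
        ≡⟨ length-++ (wordOf r (f θ)) ⟩
      length (wordOf r (f θ)) + suc (length (gapsOf a (r + blocks (f θ)) (fᴳ gs)))
        ≡⟨ cong₂ (λ m n → m + suc n) (length-word-f r θ) (trans (length-gaps-f a _ gs)
             (trans (length-gapsOf a _ gs) (sym (length-gapsOf a _ gs)))) ⟩
      length (wordOf r θ) + suc (length (gapsOf a (r + blocks θ) gs))
        ≡⟨ sym (length-++ (wordOf r θ)) ⟩
      length (wordOf r θ ++ a ∷ gapsOf a (r + blocks θ) gs) ∎
      where open ≡-Reasoning

  mutual
    -- The gaps `inv φ gs` are not structural parts of the given forest, so the recursion is bounded
    -- by the length of the word, which permuting the gaps preserves.
    f-surjective : ∀ n F → length (wordOf 0 F) ≤ n → ∃[ G ] f G ≡ F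
    f-surjective n       []            _  = [] , refl
    f-surjective (suc n) (node gs ∷ F) le =
      let hs , e  = fᴳ-surjective n (inv φ gs)
                      (subst (_≤ n) (length-gapsOf-↭ 1 1 (↭-sym (fun-↭ (inverse φ) gs)))
                        (ℕ.m+n≤o⇒m≤o _ le′))
          G  , e′ = f-surjective n F (subst (_≤ n) (length-wordOf _ F)
                      (ℕ.m+n≤o⇒n≤o (length (gapsOf 1 1 gs)) le′))
      in node hs ∷ G , cong₂ (λ ks H → node ks ∷ H) (trans (cong (fun φ) e) (fun-inv φ gs)) e′
      where
      le′ : length (gapsOf 1 1 gs) + length (wordOf (1 + blocksᴳ gs) F) ≤ n
      le′ = subst (_≤ n) (length-++ (gapsOf 1 1 gs)) (s≤s⁻¹ le)

    fᴳ-surjective : ∀ n gs → length (gapsOf 1 1 gs) ≤ n → ∃[ hs ] fᴳ hs ≡ gs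
    fᴳ-surjective n []       _  = [] , refl
    fᴳ-surjective n (θ ∷ gs) le =
      let η  , e  = f-surjective n θ (subst (_≤ n) (length-wordOf 1 θ) (ℕ.m+n≤o⇒m≤o _ le′))
          hs , e′ = fᴳ-surjective n gs (ℕ.≤-trans (ℕ.n≤1+n _) (subst (λ k → suc k ≤ n)
                      (trans (length-gapsOf 1 _ gs) (sym (length-gapsOf 1 1 gs)))
                      (ℕ.m+n≤o⇒n≤o (length (wordOf 1 θ)) le′)))
      in η ∷ hs , cong₂ _∷_ e e′
      where
      le′ : length (wordOf 1 θ) + suc (length (gapsOf 1 (1 + blocks θ) gs)) ≤ n
      le′ = subst (_≤ n) (length-++ (wordOf 1 θ)) le

  Profile : Forest → Forest → Set
  Profile F G = G ≡ F ⊎ (Full σs F × Full σs G)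

  mutual
    f-profile : ∀ F → Profile F (f F)
    f-profile [] = inj₁ refl
    f-profile (node gs ∷ F) = combine (fᴳ-profile gs) (φ-full (fᴳ gs)) (f-profile F)
      where
      tail-full : Full σs F × Full σs (f F) →
                  Full σs (node gs ∷ F) × Full σs (node (fun φ (fᴳ gs)) ∷ f F)
      tail-full (a , b) = Full-++ʳ (node gs ∷ []) F a , Full-++ʳ (node (fun φ (fᴳ gs)) ∷ []) (f F) b
      gaps-full : Full σs (concat gs) → Full σs (concat (fun φ (fᴳ gs))) →
                  Full σs (node gs ∷ F) × Full σs (node (fun φ (fᴳ gs)) ∷ f F)
      gaps-full a b = Full-node gs F a , Full-node (fun φ (fᴳ gs)) (f F) b
      combine : fᴳ gs ≡ gs ⊎ (Full σs (concat gs) × Full σs (concat (fᴳ gs))) →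
                fun φ (fᴳ gs) ≡ fᴳ gs ⊎
                  (Full σs (concat (fᴳ gs)) × Full σs (concat (fun φ (fᴳ gs)))) →
                Profile F (f F) → Profile (node gs ∷ F) (node (fun φ (fᴳ gs)) ∷ f F)
      combine _              _              (inj₂ p)  = inj₂ (tail-full p)
      combine (inj₁ e)       (inj₁ e′)      (inj₁ e″) =
        inj₁ (cong₂ (λ hs H → node hs ∷ H) (trans e′ e) e″)
      combine (inj₁ e)       (inj₂ (a , b)) _ = inj₂ (gaps-full (subst (Full σs ∘ concat) e a) b)
      combine (inj₂ (a , b)) (inj₁ e)       _ =
        inj₂ (gaps-full a (subst (Full σs ∘ concat) (sym e) b))
      -- Both steps changed something: fullness before comes from the inner one, fullness after from
      -- the outer one.
      combine (inj₂ (a , _)) (inj₂ (_ , b)) _ = inj₂ (gaps-full a b)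

    fᴳ-profile : ∀ gs → fᴳ gs ≡ gs ⊎ (Full σs (concat gs) × Full σs (concat (fᴳ gs)))
    fᴳ-profile []       = inj₁ refl
    fᴳ-profile (θ ∷ gs) with f-profile θ | fᴳ-profile gs
    ... | inj₁ e       | inj₁ e′      = inj₁ (cong₂ _∷_ e e′)
    ... | inj₂ (a , b) | _            =
      inj₂ (Full-++ˡ θ (concat gs) a , Full-++ˡ (f θ) (concat (fᴳ gs)) b)
    ... | inj₁ _       | inj₂ (a , b) =
      inj₂ (Full-++ʳ θ (concat gs) a , Full-++ʳ (f θ) (concat (fᴳ gs)) b)

  fᴳ-Covers : ∀ {σ} → σ ∈ σs → ∀ gs → Covers σ gs ⇔ Covers σ (fᴳ gs)
  fᴳ-Covers σ∈ []             = mk⇔ id id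
  fᴳ-Covers {σ} σ∈ gs@(_ ∷ _) with fᴳ-profile gs
  ... | inj₁ e       = mk⇔ (subst (Covers σ) (sym e)) (subst (Covers σ) e)
  ... | inj₂ (a , b) = mk⇔ (λ _ → (λ ()) , All.lookup b σ∈) (λ _ → (λ ()) , All.lookup a σ∈)

  fᴳ-++ : ∀ us vs → fᴳ (us ++ vs) ≡ fᴳ us ++ fᴳ vs
  fᴳ-++ []       vs = refl
  fᴳ-++ (θ ∷ us) vs = cong (f θ ∷_) (fᴳ-++ us vs)

  fᴳ-++⁻ : ∀ gs us {vs} → fᴳ gs ≡ us ++ vs →
           ∃₂ λ us′ vs′ → gs ≡ us′ ++ vs′ × fᴳ us′ ≡ us × fᴳ vs′ ≡ vs
  fᴳ-++⁻ gs       []       e = [] , gs , refl , refl , e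
  fᴳ-++⁻ (θ ∷ gs) (_ ∷ us) e with ∷-injective e
  ... | e₁ , e₂ with fᴳ-++⁻ gs us e₂
  ...   | us′ , vs′ , refl , e₃ , e₄ = θ ∷ us′ , vs′ , refl , cong₂ _∷_ e₁ e₃ , e₄

  -- Since `fᴳ` treats each gap separately, the factorizations before and after correspond, and
  -- `fᴳ-Covers` compares them factor by factor.
  fᴳ-Match : ∀ ρs → All (_∈ σs) ρs → ∀ gs → Match ρs gs ⇔ Match ρs (fᴳ gs)
  fᴳ-Match []       _        gs = mk⇔ id id
  fᴳ-Match (ρ ∷ ρs) (i ∷ is) gs = mk⇔
    (λ { (u , v , refl , c , m) → fᴳ u , fᴳ v , fᴳ-++ u v ,
           to (fᴳ-Covers i u) c , to (fᴳ-Match ρs is v) m })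
    (λ { (u , v , e , c , m) → back u c m (fᴳ-++⁻ gs u e) })
    where
    back : ∀ u {v} → Covers ρ u → Match ρs v →
           (∃₂ λ u′ v′ → gs ≡ u′ ++ v′ × fᴳ u′ ≡ u × fᴳ v′ ≡ v) → Match (ρ ∷ ρs) gs
    back u c m (u′ , v′ , e , refl , refl) =
      u′ , v′ , e , from (fᴳ-Covers i u′) c , from (fᴳ-Match ρs is v′) m

  gaps-Match : ∀ gs → Match σs gs ⇔ Match σs′ (fun φ (fᴳ gs))
  gaps-Match gs = mk⇔ (to (φ-Match (fᴳ gs)) ∘ to (fᴳ-Match σs all gs))
                      (from (fᴳ-Match σs all gs) ∘ from (φ-Match (fᴳ gs)))
    where
    all : All (_∈ σs) σs
    all = All.tabulate id

  mutual
    f-Hit : ∀ F → Hit σs F ⇔ Hit σs′ (f F)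
    f-Hit []            = mk⇔ id id
    f-Hit (node gs ∷ F) = mk⇔
      (λ { (inj₁ (inj₁ m)) → inj₁ (inj₁ (to (gaps-Match gs) m))
         ; (inj₁ (inj₂ h)) → inj₁ (inj₂ (Hitᴳ-↭ σs′ (↭-sym (fun-↭ φ (fᴳ gs))) (to (f-Hitᴳ gs) h)))
         ; (inj₂ h)        → inj₂ (to (f-Hit F) h) })
      (λ { (inj₁ (inj₁ m)) → inj₁ (inj₁ (from (gaps-Match gs) m))
         ; (inj₁ (inj₂ h)) → inj₁ (inj₂ (from (f-Hitᴳ gs) (Hitᴳ-↭ σs′ (fun-↭ φ (fᴳ gs)) h)))
         ; (inj₂ h)        → inj₂ (from (f-Hit F) h) })

    f-Hitᴳ : ∀ gs → Hitᴳ σs gs ⇔ Hitᴳ σs′ (fᴳ gs)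
    f-Hitᴳ []       = mk⇔ id id
    f-Hitᴳ (θ ∷ gs) = mk⇔
      (λ { (inj₁ h) → inj₁ (to (f-Hit θ) h) ; (inj₂ h) → inj₂ (to (f-Hitᴳ gs) h) })
      (λ { (inj₁ h) → inj₁ (from (f-Hit θ) h) ; (inj₂ h) → inj₂ (from (f-Hitᴳ gs) h) })

parseAll : ∀ {σs} → All IsNonCrossing σs → ∃[ ps ] map (wordOf 0) ps ≡ σs
parseAll []         = [] , refl
parseAll (nc ∷ ncs) =
  let P , e = parse nc ; ps , es = parseAll ncs in P ∷ ps , cong₂ _∷_ e es

interleave1-nonCrossing : ∀ {σs} → All IsNonCrossing σs → IsNonCrossing (interleave1 σs)
interleave1-nonCrossing ncs with parseAll ncs
... | ps , refl = subst IsNonCrossing (trans (wordOf-tree ps) (sym (interleave1-treeWord ps)))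
                    (wordOf-isNonCrossing (node ps ∷ []))

contains⇔Hit : ∀ {σs} → All IsNonCrossing σs → ∀ F →
               Contains (wordOf 0 F) (interleave1 σs) ⇔ Hit σs F
contains⇔Hit ncs F with parseAll ncs
... | ps , refl = mk⇔
  (Has⇒Hit ps F ∘ subst (Has (wordOf 0 F)) (interleave1-treeWord ps) ∘ Contains⇒Has)
  (Has⇒Contains ∘ subst (Has (wordOf 0 F)) (sym (interleave1-treeWord ps)) ∘ Hit⇒Has ps F)

GapBijection⇒CCEquivalent : ∀ {σs σs′} → All IsNonCrossing σs → All IsNonCrossing σs′ →
                            GapBijection σs σs′ → CCEquivalent (interleave1 σs) (interleave1 σs′)
GapBijection⇒CCEquivalent {σs} {σs′} ncs ncs′ β = record
  { nonCrossingˡ = interleave1-nonCrossing ncs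
  ; nonCrossingʳ = interleave1-nonCrossing ncs′
  ; bijection = mk⤖ {to = forward} (injective , surjective)
  ; size-preserving = λ π → trans (length-word-f 0 (forest π)) (cong length (word-forest π))
  ; components-preserving = λ π m → subst
      (λ w → HasComponents w m ⇔ HasComponents (word (forward π)) m) (word-forest π)
      (HasComponents-cong (forest π) (f (forest π)) (sym (length-f (forest π))) m)
  }
  where
  open Recursion β

  forest : ∀ {σ} → Avoider σ → Forest
  forest π = proj₁ (parse (isPartition π , avoids-1212 π))

  word-forest : ∀ {σ} (π : Avoider σ) → wordOf 0 (forest π) ≡ word π
  word-forest π = proj₂ (parse (isPartition π , avoids-1212 π))

  fromForest : ∀ {σ} F → Avoids (wordOf 0 F) σ → Avoider σ
  fromForest F a = avoider (wordOf 0 F) (wordOf-isPartition F) (wordOf-avoids-1212 F) a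

  forward : Avoider (interleave1 σs) → Avoider (interleave1 σs′)
  forward π = fromForest (f (forest π))
    (λ c → avoids π (subst (λ w → Contains w (interleave1 σs)) (word-forest π)
      (from (contains⇔Hit ncs (forest π)) (from (f-Hit (forest π))
        (to (contains⇔Hit ncs′ (f (forest π))) c)))))

  injective : ∀ {x y} → forward x ≡ forward y → x ≡ y
  injective {x} {y} e = Avoider-≡ (trans (sym (word-forest x)) (trans
    (cong (wordOf 0) (f-injective _ _ (wordOf-injective 0 _ _ (cong word e)))) (word-forest y)))

  surjective : ∀ y → ∃[ x ] (∀ {z} → z ≡ x → forward z ≡ y)
  surjective y = x , λ { refl → Avoider-≡ (trans (cong (wordOf 0 ∘ f) forest-x)
                                   (trans (cong (wordOf 0) fG) (word-forest y))) }
    where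
    preimage = f-surjective _ (forest y) ℕ.≤-refl
    G  = proj₁ preimage
    fG = proj₂ preimage
    x  = fromForest G (λ c → avoids y (subst (λ w → Contains w (interleave1 σs′))
           (trans (cong (wordOf 0) fG) (word-forest y))
           (from (contains⇔Hit ncs′ (f G)) (to (f-Hit G) (to (contains⇔Hit ncs G) c)))))
    -- Here `forest x` comes from parsing the word of `G` afresh; injectivity of `wordOf` shows that
    -- parsing returns `G`.
    forest-x : forest x ≡ G
    forest-x = wordOf-injective 0 _ _ (word-forest x)

-- Exchanging two neighbouring patterns

module _ (σ τ : Word) (after : List Word) (σ-rev : ReversalInvariant σ) where

  private
    Covers-reverse : ∀ gs → Covers σ gs → Covers σ (reverse gs)
    Covers-reverse []       (ne , h) = ⊥-elim (ne refl)
    Covers-reverse gs@(θ ∷ _) (ne , h) = ne′ , σ-rev gs h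
      where
      ne′ : reverse gs ≢ []
      ne′ e with trans (sym (reverse-involutive gs)) (cong reverse e)
      ... | ()

  swapGaps : List Word → Rearrangement {Forest}
  swapGaps []           = exchange (Covers? σ) (Match? after)
  swapGaps (ρ ∷ before) = afterFirstᴿ (Covers? ρ) (swapGaps before)

  swapGaps-Match : ∀ before gs → Match (before ++ σ ∷ τ ∷ after) gs ⇔
                                 Match (before ++ τ ∷ σ ∷ after) (fun (swapGaps before) gs)
  swapGaps-Match [] = exchange-⋆ (Covers? σ) (Match? after)
    (λ gs → mk⇔ (Covers-reverse gs)
      (subst (Covers σ) (reverse-involutive gs) ∘ Covers-reverse (reverse gs)))
    Covers-leftClosed Covers-rightClosed Covers-leftClosed Covers-rightClosed
  swapGaps-Match (ρ ∷ before) = afterFirst-⋆ (Covers? ρ)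
    (Match-leftClosed (before ++ σ ∷ τ ∷ after)) (Match-leftClosed (before ++ τ ∷ σ ∷ after))
    (swapGaps-Match before)

  gapBijection : ∀ before → GapBijection (before ++ σ ∷ τ ∷ after) (before ++ τ ∷ σ ∷ after)
  gapBijection before = record
    { φ       = inducedᴿ K? (swapGaps before)
    ; φ-Match = induced-⇔ K? (swapGaps before) (swapGaps-Match before) (Match⇒Covers σs)
                  (λ m → All-resp-↭ (↭.++⁺ˡ before (↭.swap τ σ ↭-refl)) (Match⇒Covers σs′ m))
    ; φ-full  = λ gs → full gs (induced-fixed-or-K K? (swapGaps before) gs) }
    where
    σs  = before ++ σ ∷ τ ∷ after
    σs′ = before ++ τ ∷ σ ∷ after
    -- The order of the patterns is irrelevant to this condition, so a match of `σs` and a match of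
    -- `σs′` both imply it, as the first-return construction demands.
    K : List Forest → Set
    K gs = All (λ ρ → Covers ρ gs) σs
    K? : ∀ gs → Dec (K gs)
    K? gs = All.all? (λ ρ → Covers? ρ gs) σs
    full : ∀ gs {hs} → hs ≡ gs ⊎ (K gs × K hs) →
           hs ≡ gs ⊎ (Full σs (concat gs) × Full σs (concat hs))
    full gs (inj₁ e)       = inj₁ e
    full gs (inj₂ (a , b)) = inj₂ (All.map proj₂ a , All.map proj₂ b)

theorem3p5 : (before : List Word) (σq σq+1 : Word) (after : List Word) →
    All IsNonCrossing (before ++ σq ∷ σq+1 ∷ after) →
    (σq ≡ [] ⊎ Connected σq ⊎ OnlySingletonBlocks σq) →
    CCEquivalent (interleave1 (before ++ σq ∷ σq+1 ∷ after))
    (interleave1 (before ++ σq+1 ∷ σq ∷ after))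
theorem3p5 before σq σq+1 after ncs hyp =
  GapBijection⇒CCEquivalent ncs (All-resp-↭ (↭.++⁺ˡ before (↭.swap σq σq+1 ↭-refl)) ncs)
    (gapBijection σq σq+1 after (reversalInvariant (All.head (++⁻ʳ before ncs)) hyp) before)
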